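{- Let $\Gamma$ be a green Veldkamp quadrangle and let $\bar\Gamma$ be the graph with local opposition relations defined below. Then $\bar\Gamma$ is a flat green Veldkamp quadrangle (with point set $\bar P$ and line set $\bar L$). Moreover, $\Gamma$ is flat if and only if all classes $[a]$ ($a\in P$) and $[x]$ ($x\in L$) are singletons, i.e. $\bar\Gamma$ can be identified with $\Gamma$. Furthermore, if $\Gamma$ is $k$-plump for some $k\ge3$, then so is $\bar\Gamma$.
   Context: A graph is a pair $(V,E)$ with $E$ a set of $2$-element subsets of $V$; $\Gamma_v$ is the set of neighbors of $v$. An $s$-path is a sequence $(x_0,\dots,x_s)$ of vertices with consecutive vertices adjacent and $x_{i-2}\ne x_i$ for $i\in[2,s]$; ${\rm dist}$ is graph distance. A closed $s$-path is an $s$-path with $s\ge3$ whose first and last vertices coincide; an $s$-circuit is the subgraph determined by a closed $s$-path. An opposition relation on a set $X$ is a symmetric anti-reflexive relation; trivial if any two distinct elements are related; $k$-plump if for every $S\subseteq X$ with $|S|\le k$ some element of $X$ is related to all elements of $S$. A Veldkamp graph is a graph with a $2$-plump opposition relation $\equiv_v$ on $\Gamma_v$ for each vertex $v$; it is $k$-plump if all $\equiv_v$ are. A path $(v_0,\dots,v_s)$ is straight if $v_{i-1}\equiv_{v_i}v_{i+1}$ for all $i\in[1,s-1]$; a circuit is straight if every path in it is straight. A Veldkamp $n$-gon ($n\ge2$) is a Veldkamp graph satisfying (VP1) connected and bipartite; (VP2) for each $k\in[1,n-1]$ each straight $k$-path is the unique straight path between its endpoints of length at most $k$; (VP3) every straight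 $(n+1)$-path lies in a straight $2n$-circuit. A root is a straight $n$-path; two vertices are opposite if there is a root between them; $x^{\rm op}$ is the set of vertices opposite $x$; the polygon is flat if $x^{\rm op}=y^{\rm op}$ implies $x=y$. A Veldkamp quadrangle is a Veldkamp $4$-gon, with bipartition classes called points $P$ and lines $L$; it is green if $\equiv_x$ is trivial for every line $x$. A weed is a non-straight $4$-path $(a,x,b,y,c)$ with $a,b,c\in P$ and ${\rm dist}(a,c)=4$. For $a,b\in P$, $a\simeq b$ means $a=b$ or there is a weed from $a$ to $b$; this is an equivalence relation on $P$, with class $[a]$. For $x,y\in L$, $x\sim y$ means some weed contains both $x$ and $y$; $\approx$ is the reflexive-transitive closure of $\sim$, with class $[x]$. The graph $\bar\Gamma$: its vertex set is the disjoint union of $\bar P=\{[a]\mid a\in P\}$ and $\bar L=\{[x]\mid x\in L\}$; $[a]$ and $[x]$ are adjacent iff some element of $[a]$ is adjacent in $\Gamma$ to some element of $[x]$. Two neighbors of $[x]\in\bar L$ are opposite at $[x]$ iff they are distinct; two neighbors $[x],[y]$ of $[a]\in\bar P$ are opposite at $[a]$ iff there is a point $b\in[a]$ such that every line in $\Gamma_b\cap[x]$ is opposite (at $b$) every line in $\Gamma_b\cap[y]$. -}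

module Defs where

open import Data.Empty.Polymorphic using (⊥)
open import Data.List.Base using (List; length)
open import Data.List.Relation.Unary.All using (All)
open import Data.Nat.Base using (ℕ; suc; _+_; _*_; _≤_; _<_)
open import Data.Product.Base using (Σ; ∃; ∃-syntax; _×_; _,_; proj₁)
open import Data.Sum.Base using (_⊎_; inj₁; inj₂)
open import Data.Sum.Relation.Binary.Pointwise as Sum using ()
open import Data.Unit.Polymorphic using (⊤)
open import Data.Vec.Base using (Vec; []; _∷_; head; last)
open import Data.Vec.Relation.Binary.Pointwise.Inductive as Vec using ()
open import Data.Vec.Relation.Unary.Any using (Any)
open import Function.Bundles using (_⇔_)
open import Function.Definitions using (Congruent; Bijective)
open import Level using (Level; _⊔_) renaming (suc to lsuc)
open import Relation.Binary.Core using (Rel)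
open import Relation.Binary.Construct.Closure.ReflexiveTransitive using (Star)
open import Relation.Binary.PropositionalEquality.Core using (_≡_; refl)
open import Relation.Binary.Structures using (IsEquivalence)
open import Relation.Nullary.Negation.Core using (¬_)
open import Relation.Unary using (Pred)

private
  variable
    a c ℓ ℓ′ : Level

-- An opposition relation on the set X, which is given as a subset of an
-- ambient type A with equality _≈_; domain says that R relates only
-- elements of X.

record IsOpposition {A : Set a} (_≈_ : Rel A ℓ) (X : Pred A ℓ)
                    (R : Rel A ℓ) : Set (a ⊔ ℓ) where
  field
    domain   : ∀ {x y} → R x y → X x × X y
    sym      : ∀ {x y} → R x y → R y x
    antirefl : ∀ {x y} → R x y → ¬ (x ≈ y)

TrivialOpposition : {A : Set a} → Rel A ℓ → Pred A ℓ → Rel A ℓ → Set (a ⊔ ℓ)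
TrivialOpposition _≈_ X R = ∀ x y → X x → X y → ¬ (x ≈ y) → R x y

-- The subsets of X with at most k elements are exactly the sets of
-- entries of the lists over X of length at most k.

Plump : {A : Set a} → ℕ → Pred A ℓ → Rel A ℓ → Set (a ⊔ ℓ)
Plump {A = A} k X R =
  (S : List A) → All X S → length S ≤ k → ∃[ x ] (X x × All (R x) S)

-- Vertices are taken up to _≈_, so that the graph of classes can be
-- formed without quotient types; that _≈_ is an equivalence is part of
-- IsVeldkampGraph.  Opp v x y means x ≡ᵥ y.

record RawVeldkampGraph c ℓ : Set (lsuc (c ⊔ ℓ)) where
  field
    V   : Set c
    _≈_ : Rel V ℓ
    Adj : Rel V ℓ
    Opp : V → Rel V ℓ

record IsVeldkampGraph (G : RawVeldkampGraph c ℓ) : Set (c ⊔ ℓ) where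
  open RawVeldkampGraph G
  field
    isEquivalence : IsEquivalence _≈_
    adj-resp      : ∀ {u u′ v v′} → u ≈ u′ → v ≈ v′ → Adj u v → Adj u′ v′
    adj-sym       : ∀ {u v} → Adj u v → Adj v u
    adj-irrefl    : ∀ {u v} → Adj u v → ¬ (u ≈ v)
    opp-resp      : ∀ {v v′ x x′ y y′} → v ≈ v′ → x ≈ x′ → y ≈ y′ →
                    Opp v x y → Opp v′ x′ y′
    opposition    : ∀ v → IsOpposition _≈_ (Adj v) (Opp v)
    2-plump       : ∀ v → Plump 2 (Adj v) (Opp v)

PlumpGraph : ℕ → RawVeldkampGraph c ℓ → Set (c ⊔ ℓ)
PlumpGraph k G = ∀ v → Plump k (Adj v) (Opp v)
  where open RawVeldkampGraph G

data Side : Set where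
  point line : Side

module _ (G : RawVeldkampGraph c ℓ) where
  open RawVeldkampGraph G

  record IsBipartition (side : V → Side) : Set (c ⊔ ℓ) where
    field
      side-resp : ∀ {u v} → u ≈ v → side u ≡ side v
      side-adj  : ∀ {u v} → Adj u v → ¬ (side u ≡ side v)

  -- Paths with respect to an arbitrary edge relation, so that the notion
  -- also applies to subgraphs; an s-path has s + 1 entries.

  IsPath : ∀ {s} → Rel V ℓ → Vec V (suc s) → Set ℓ
  IsPath E (x ∷ [])        = ⊤
  IsPath E (x ∷ y ∷ [])    = E x y
  IsPath E (x ∷ y ∷ z ∷ p) = E x y × ¬ (x ≈ z) × IsPath E (y ∷ z ∷ p)

  Straight : ∀ {s} → Vec V (suc s) → Set ℓ
  Straight (x ∷ [])        = ⊤
  Straight (x ∷ y ∷ [])    = ⊤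
  Straight (x ∷ y ∷ z ∷ p) = Opp y x z × Straight (y ∷ z ∷ p)

  StraightPath : ∀ {s} → Vec V (suc s) → Set ℓ
  StraightPath p = IsPath Adj p × Straight p

  Joins : ∀ {s} → Vec V (suc s) → V → V → Set ℓ
  Joins p x y = head p ≈ x × last p ≈ y

  PathOfLength : ℕ → Rel V (c ⊔ ℓ)
  PathOfLength s x y = Σ (Vec V (suc s)) λ p → IsPath Adj p × Joins p x y

  Connected : Set (c ⊔ ℓ)
  Connected = ∀ x y → ∃[ s ] PathOfLength s x y

  Dist : V → V → ℕ → Set (c ⊔ ℓ)
  Dist x y d = PathOfLength d x y × (∀ s → PathOfLength s x y → d ≤ s)

  ClosedPath : ∀ {s} → Vec V (suc s) → Set ℓ
  ClosedPath {s} p = 3 ≤ s × IsPath Adj p × head p ≈ last p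

  -- The edges of the subgraph determined by p.

  EdgeOf : ∀ {s} → Vec V (suc s) → Rel V ℓ
  EdgeOf (x ∷ [])    u v = ⊥
  EdgeOf (x ∷ y ∷ p) u v =
    (u ≈ x × v ≈ y) ⊎ (u ≈ y × v ≈ x) ⊎ EdgeOf (y ∷ p) u v

  StraightCircuit : ∀ {s} → Vec V (suc s) → Set (c ⊔ ℓ)
  StraightCircuit p =
    ClosedPath p ×
    (∀ {r} (q : Vec V (suc r)) → IsPath (EdgeOf p) q → Straight q)

  record IsVeldkampPolygon (n : ℕ) : Set (c ⊔ ℓ) where
    field
      n≥2             : 2 ≤ n
      isVeldkampGraph : IsVeldkampGraph G
      connected       : Connected
      bipartite       : ∃ IsBipartition
      uniqueness      : ∀ k → 1 ≤ k → k < n →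
                        (p : Vec V (suc k)) → StraightPath p →
                        ∀ m → m ≤ k →
                        (q : Vec V (suc m)) → StraightPath q →
                        Joins q (head p) (last p) →
                        Vec.Pointwise _≈_ q p
      extension       : (p : Vec V (suc (n + 1))) → StraightPath p →
                        Σ (Vec V (suc (2 * n))) λ z →
                        StraightCircuit z × IsPath (EdgeOf z) p

  IsRoot : ∀ n → Vec V (suc n) → Set ℓ
  IsRoot n p = StraightPath p

  Opposite : ℕ → Rel V (c ⊔ ℓ)
  Opposite n x y = Σ (Vec V (suc n)) λ p → IsRoot n p × Joins p x y

  Flat : ℕ → Set (c ⊔ ℓ)
  Flat n = ∀ x y → (∀ z → Opposite n x z ⇔ Opposite n y z) → x ≈ y

  -- A quadrangle comes with a choice of which bipartition class consists
  -- of the points.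

  record IsGreenVeldkampQuadrangle (side : V → Side) : Set (c ⊔ ℓ) where
    field
      isVeldkampPolygon : IsVeldkampPolygon 4
      isBipartition     : IsBipartition side
      green             : ∀ x → side x ≡ line →
                          TrivialOpposition _≈_ (Adj x) (Opp x)

module Classes (G : RawVeldkampGraph c ℓ)
               (side : RawVeldkampGraph.V G → Side) where
  open RawVeldkampGraph G

  P L : Set c
  P = Σ V λ v → side v ≡ point
  L = Σ V λ v → side v ≡ line

  IsWeed : V → V → V → V → V → Set (c ⊔ ℓ)
  IsWeed a x b y c =
    IsPath G Adj w × ¬ Straight G w ×
    (side a ≡ point × side b ≡ point × side c ≡ point) ×
    Dist G a c 4
    where w = a ∷ x ∷ b ∷ y ∷ c ∷ []

  infix 4 _≃_ _∼_ _≋_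

  _≃_ : Rel P (c ⊔ ℓ)
  (a , _) ≃ (b , _) = a ≈ b ⊎ (∃[ x ] ∃[ m ] ∃[ y ] IsWeed a x m y b)

  _∼_ : Rel L (c ⊔ ℓ)
  (x , _) ∼ (y , _) =
    ∃[ a ] ∃[ u ] ∃[ b ] ∃[ v ] ∃[ d ]
      let w = a ∷ u ∷ b ∷ v ∷ d ∷ [] in
      IsWeed a u b v d × Any (x ≈_) w × Any (y ≈_) w

  -- The reflexive-transitive closure of _∼_, called ≈ in the
  -- mathematical text.  Star is reflexive only for propositional
  -- equality, hence the extra steps along the vertex equality.

  _≋_ : Rel L (c ⊔ ℓ)
  _≋_ = Star λ x y → proj₁ x ≈ proj₁ y ⊎ x ∼ y

  V̄ : Set c
  V̄ = P ⊎ L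

  Incident : P → L → Set (c ⊔ ℓ)
  Incident a x = ∃[ a′ ] ∃[ x′ ] (a′ ≃ a × x′ ≋ x × Adj (proj₁ a′) (proj₁ x′))

  Adj̄ : Rel V̄ (c ⊔ ℓ)
  Adj̄ (inj₁ a) (inj₂ x) = Incident a x
  Adj̄ (inj₂ x) (inj₁ a) = Incident a x
  Adj̄ (inj₁ _) (inj₁ _) = ⊥
  Adj̄ (inj₂ _) (inj₂ _) = ⊥

  Opp̄ : V̄ → Rel V̄ (c ⊔ ℓ)
  Opp̄ (inj₂ x) (inj₁ a) (inj₁ b) = Incident a x × Incident b x × ¬ (a ≃ b)
  Opp̄ (inj₁ a) (inj₂ x) (inj₂ y) =
    Incident a x × Incident a y ×
    ∃[ b ] (b ≃ a ×
            (∀ u v → Adj (proj₁ b) (proj₁ u) → u ≋ x →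
                     Adj (proj₁ b) (proj₁ v) → v ≋ y →
                     Opp (proj₁ b) (proj₁ u) (proj₁ v)))
  Opp̄ _ _ _ = ⊥

  Γ̄ : RawVeldkampGraph c (c ⊔ ℓ)
  Γ̄ = record { V = V̄ ; _≈_ = Sum.Pointwise _≃_ _≋_ ; Adj = Adj̄ ; Opp = Opp̄ }

  classSide : V̄ → Side
  classSide (inj₁ _) = point
  classSide (inj₂ _) = line

  ClassesAreSingletons : Set (c ⊔ ℓ)
  ClassesAreSingletons =
    (∀ a b → b ≃ a → proj₁ b ≈ proj₁ a) × (∀ x y → y ≋ x → proj₁ y ≈ proj₁ x)

  toClass : V → V̄
  toClass v = go (side v) refl
    where
    go : ∀ s → side v ≡ s → V̄
    go point eq = inj₁ (v , eq)
    go line  eq = inj₂ (v , eq)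

record IsIsomorphism (G : RawVeldkampGraph c ℓ) (H : RawVeldkampGraph a ℓ′)
                     (f : RawVeldkampGraph.V G → RawVeldkampGraph.V H)
                     : Set (a ⊔ c ⊔ ℓ ⊔ ℓ′) where
  private
    module G = RawVeldkampGraph G
    module H = RawVeldkampGraph H
  field
    congruent : Congruent G._≈_ H._≈_ f
    bijective : Bijective G._≈_ H._≈_ f
    adj⇔      : ∀ u v → G.Adj u v ⇔ H.Adj (f u) (f v)
    opp⇔      : ∀ v x y → G.Opp v x y ⇔ H.Opp (f v) (f x) (f y)

{-# OPTIONS --safe #-}

-- Call two points collinear if they lie on a common line and opposite if they are joined by a
-- root.  In a green Veldkamp quadrangle every 4-path between opposite points is straight, so
-- that a ≃ b means that a = b or that a and b are neither collinear nor opposite.  Two points that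
-- are ≃-related to a third one are never opposite; hence a ≃ b exactly when a and b have the same
-- opposites.  A weed (a , x , b , y , c) forces x and y to be opposite the same lines at b, and
-- this in turn forces x and y to have the same point classes.  Conversely two lines with two common
-- point classes are in the same class.  So opposition in Γ̄ can be read off from opposition of
-- points in Γ, and the axioms for Γ̄ follow by choosing representatives.

module Submission where

open import Defs
open import Axiom.ExcludedMiddle using (ExcludedMiddle)
open import Data.Empty using (⊥; ⊥-elim)
open import Data.List.Base using (List; []; _∷_; length)
open import Data.List.Relation.Unary.All using (All; []; _∷_)
open import Data.Nat.Base using (ℕ; zero; suc; _≤_; _<_; z≤n; s≤s)
open import Data.Product.Base using (Σ; ∃-syntax; _×_; _,_; proj₁; proj₂)
open import Data.Sum.Base using (_⊎_; inj₁; inj₂)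
open import Data.Sum.Relation.Binary.Pointwise as Sum using ()
open import Data.Unit.Base using (⊤)
open import Data.Unit.Polymorphic using (tt)
open import Data.Vec.Base using (Vec; []; _∷_; head; last; tail; _∷ʳ_; reverse)
open import Data.Vec.Properties using (reverse-∷)
open import Data.Vec.Relation.Binary.Pointwise.Inductive as Pointwise using ([]; _∷_)
open import Data.Vec.Relation.Unary.Any using (Any; here; there)
open import Function.Base using (_∋_)
open import Function.Bundles using (_⇔_; mk⇔; Equivalence)
open import Level using (Level; _⊔_; Lift; lift; lower) renaming (suc to lsuc)
open import Relation.Binary.Construct.Closure.ReflexiveTransitive using (Star; ε; _◅_; _◅◅_)
open import Relation.Binary.PropositionalEquality.Core using (_≡_; refl; sym; trans; cong; subst)
open import Relation.Binary.Structures using (IsEquivalence)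
open import Relation.Nullary using (¬_; Dec; yes; no)
open import Relation.Nullary.Decidable using (map′; decidable-stable)

-- Nothing excludes triangles, so a line may have several points collinear with a given point `a`,
-- and projection to a line is not unique. What replaces uniqueness is a dichotomy: as soon as a
-- line has a point opposite `a`, exactly one of its points is collinear with `a` and all others are
-- opposite `a`. This is why so many arguments first produce an opposite point.
--
-- Opposition at a point class asks for one representative at which all lines of two classes are
-- opposite, which is awkward to transport. `Opposite̅` asks instead for two opposite points on the
-- two line classes; as `_op_` is constant on classes, this yields opposition at every
-- representative.
--
-- A circuit is straight only if all paths in it are, so accidental coincidences of its vertices
-- matter. Uniqueness of straight paths excludes them, and the circuit axiom becomes a statement
-- about cyclic 8-tuples with eight straight corners.

other : Side → Side
other point = line
other line  = point

other-involutive : ∀ s → other (other s) ≡ s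
other-involutive point = refl
other-involutive line  = refl

other-≢ : ∀ s → ¬ (s ≡ other s)
other-≢ point ()
other-≢ line  ()

≢⇒other : ∀ s t → ¬ (s ≡ t) → t ≡ other s
≢⇒other point point s≢t = ⊥-elim (s≢t refl)
≢⇒other point line  _   = refl
≢⇒other line  point _   = refl
≢⇒other line  line  s≢t = ⊥-elim (s≢t refl)

Uniqueness : ∀ {c ℓ} → RawVeldkampGraph c ℓ → ℕ → Set (c ⊔ ℓ)
Uniqueness G n = ∀ k → 1 ≤ k → k < n →
  (p : Vec V (suc k)) → StraightPath G p →
  ∀ m → m ≤ k → (q : Vec V (suc m)) → StraightPath G q →
  Joins G q (head p) (last p) → Pointwise.Pointwise _≈_ q p
  where open RawVeldkampGraph G

-- Paths in bipartite Veldkamp graphs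

module VeldkampGraph {c ℓ} {G : RawVeldkampGraph c ℓ} (isVG : IsVeldkampGraph G)
                     {side : RawVeldkampGraph.V G → Side} (bip : IsBipartition G side) where
  open RawVeldkampGraph G
  open IsVeldkampGraph isVG
  open IsBipartition bip
  open IsEquivalence isEquivalence public
    renaming (refl to ≈-refl; sym to ≈-sym; trans to ≈-trans) using ()

  private
    variable
      a b d s t u u′ v v′ w w′ x : V

  opp-sym : Opp v u w → Opp v w u
  opp-sym {v} = IsOpposition.sym (opposition v)

  opp⇒adjˡ : Opp v u w → Adj v u
  opp⇒adjˡ {v} o = proj₁ (IsOpposition.domain (opposition v) o)

  opp⇒adjʳ : Opp v u w → Adj v w
  opp⇒adjʳ o = opp⇒adjˡ (opp-sym o)

  opp⇒≉ : Opp v u w → ¬ (u ≈ w)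
  opp⇒≉ {v} = IsOpposition.antirefl (opposition v)

  adj⇒other : Adj u v → side v ≡ other (side u)
  adj⇒other adj = ≢⇒other _ _ (side-adj adj)

  adj²⇒≡ : Adj u v → Adj v w → side w ≡ side u
  adj²⇒≡ {u = u} uv vw =
    trans (adj⇒other vw) (trans (cong other (adj⇒other uv)) (other-involutive (side u)))

  adj³⇒other : Adj u v → Adj v w → Adj w x → side x ≡ other (side u)
  adj³⇒other uv vw wx = trans (adj⇒other wx) (cong other (adj²⇒≡ uv vw))

  adj³⇒≉ : Adj u v → Adj v w → Adj w x → ¬ (u ≈ x)
  adj³⇒≉ uv vw wx u≈x = other-≢ _ (trans (side-resp u≈x) (adj³⇒other uv vw wx))

  straight₂ : Opp v u w → StraightPath G (u ∷ v ∷ w ∷ [])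
  straight₂ o = (adj-sym (opp⇒adjˡ o) , opp⇒≉ o , opp⇒adjʳ o) , o , tt

  straight-∷ : ∀ {n} {p : Vec V n} → Opp v u w →
               StraightPath G (v ∷ w ∷ p) → StraightPath G (u ∷ v ∷ w ∷ p)
  straight-∷ o (path , str) = (adj-sym (opp⇒adjˡ o) , opp⇒≉ o , path) , o , str

  straight₃ : Opp v u w → Opp w v x → StraightPath G (u ∷ v ∷ w ∷ x ∷ [])
  straight₃ o₁ o₂ = straight-∷ o₁ (straight₂ o₂)

  straight₄ : Opp v u w → Opp w v x → Opp x w d → StraightPath G (u ∷ v ∷ w ∷ x ∷ d ∷ [])
  straight₄ o₁ o₂ o₃ = straight-∷ o₁ (straight₃ o₂ o₃)

  IsPath-tail : ∀ {n} {E : V → V → Set ℓ} {p : Vec V (suc n)} → IsPath G E (u ∷ p) → IsPath G E p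
  IsPath-tail {p = v ∷ []}    _            = tt
  IsPath-tail {p = v ∷ w ∷ p} (_ , _ , pp) = pp

  IsPath-first : ∀ {n} {E : V → V → Set ℓ} {p : Vec V n} → IsPath G E (u ∷ v ∷ p) → E u v
  IsPath-first {p = []}    uv       = uv
  IsPath-first {p = _ ∷ _} (uv , _) = uv

  IsPath-map : ∀ {n} {E F : V → V → Set ℓ} → (∀ {u v} → E u v → F u v) →
               (p : Vec V (suc n)) → IsPath G E p → IsPath G F p
  IsPath-map f (u ∷ [])        _                = tt
  IsPath-map f (u ∷ v ∷ [])    uv               = f uv
  IsPath-map f (u ∷ v ∷ w ∷ p) (uv , u≉w , pp) = f uv , u≉w , IsPath-map f (v ∷ w ∷ p) pp

  module _ (_≈?_ : ∀ u v → Dec (u ≈ v)) where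

    -- Paths may not backtrack: if the new first vertex `u` equals the third vertex `y`, then `u`
    -- and the vertex between them are dropped.
    walk⇒path : Star Adj u v → ∃[ n ] PathOfLength G n u v
    walk⇒path ε = 0 , (_ ∷ []) , tt , ≈-refl , ≈-refl
    walk⇒path {u} (uv ◅ walk) with walk⇒path walk
    ... | n , (x ∷ []) , _ , x≈v , x≈w =
      1 , (u ∷ x ∷ []) , adj-resp ≈-refl (≈-sym x≈v) uv , ≈-refl , x≈w
    ... | suc n , (x ∷ y ∷ p) , path , x≈v , y≈w with u ≈? y
    ...   | yes u≈y = n , (y ∷ p) , IsPath-tail {E = Adj} {p = y ∷ p} path , ≈-sym u≈y , y≈w
    ...   | no  u≉y = suc (suc n) , (u ∷ x ∷ y ∷ p) ,
                      (adj-resp ≈-refl (≈-sym x≈v) uv , u≉y , path) , ≈-refl , y≈w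

  -- Reduction of the uniqueness axiom to straight 2-paths and 3-paths

  module _ (unique₂ : ∀ {u v v′ w} → Opp v u w → Opp v′ u w → v′ ≈ v)
           (unique₃ : ∀ {u v v′ w w′ x} → side u ≡ point →
                      Opp v u w → Opp w v x → Opp v′ u w′ → Opp w′ v′ x → w′ ≈ w)
           (green : ∀ x → side x ≡ line → TrivialOpposition _≈_ (Adj x) (Opp x)) where

    private
      2-1 : Opp v u w → Adj u′ w′ → u′ ≈ u → w′ ≈ w → ⊥
      2-1 o uw u≈ w≈ =
        side-adj (adj-resp u≈ w≈ uw) (sym (adj²⇒≡ (adj-sym (opp⇒adjˡ o)) (opp⇒adjʳ o)))

      -- The end `x` is a line, so by greenness `u`, `x`, `w` is straight; comparison with `u`, `v`,
      -- `w` gives `x` = `v`, against the bend at `w`.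
      3-1 : side u ≡ point → Opp v u w → Opp w v x → Adj u x → ⊥
      3-1 u-pt o₁ o₂ ux = opp⇒≉ o₂ (≈-sym (unique₂ o₁
        (green _ x-line _ _ (adj-sym ux) (adj-sym (opp⇒adjʳ o₂)) (opp⇒≉ o₁))))
        where x-line = trans (adj⇒other ux) (cong other u-pt)

      3-3 : side u ≡ point → Opp v u w → Opp w v x → Opp v′ u w′ → Opp w′ v′ x → v′ ≈ v × w′ ≈ w
      3-3 u-pt o₁ o₂ o₃ o₄ =
        unique₂ o₁ (opp-resp ≈-refl ≈-refl w′≈w o₃) , w′≈w
        where w′≈w = unique₃ u-pt o₁ o₂ o₃ o₄

      -- A straight 3-path has a point at exactly one end, so that it may be read from there.
      either-end : side u ≡ point ⊎ (Adj u v → Adj v w → Adj w x → side x ≡ point)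
      either-end {u} with side u in eq
      ... | point = inj₁ refl
      ... | line  = inj₂ λ uv vw wx →
        trans (adj³⇒other uv vw wx) (cong other eq)

    -- Lengths of different parity are ruled out by the sides, and k = 2 with m = 0 by
    -- antireflexivity. Besides the hypotheses themselves only a straight 3-path with adjacent ends
    -- needs an argument, and `3-1` supplies it.
    uniqueness₄ : Uniqueness G 4
    uniqueness₄ zero () _ _ _ _ _ _ _ _
    uniqueness₄ (suc (suc (suc (suc k)))) _ (s≤s (s≤s (s≤s (s≤s ())))) _ _ _ _ _ _ _
    uniqueness₄ 1 _ _ (u ∷ v ∷ []) (uv , _) 0 _ (x ∷ []) _ (x≈u , x≈v) =
      ⊥-elim (adj-irrefl uv (≈-trans (≈-sym x≈u) x≈v))
    uniqueness₄ 1 _ _ (u ∷ v ∷ []) _ 1 _ (x ∷ y ∷ []) _ (x≈u , y≈v) = x≈u ∷ y≈v ∷ []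
    uniqueness₄ 1 _ _ _ _ (suc (suc m)) (s≤s ()) _ _ _
    uniqueness₄ 2 _ _ (u ∷ v ∷ w ∷ []) (_ , o , _) 0 _ (x ∷ []) _ (x≈u , x≈w) =
      ⊥-elim (opp⇒≉ o (≈-trans (≈-sym x≈u) x≈w))
    uniqueness₄ 2 _ _ (u ∷ v ∷ w ∷ []) (_ , o , _) 1 _ (x ∷ y ∷ []) (xy , _) (x≈u , y≈w) =
      ⊥-elim (2-1 o xy x≈u y≈w)
    uniqueness₄ 2 _ _ (u ∷ v ∷ w ∷ []) (_ , o , _) 2 _ (x ∷ y ∷ z ∷ []) (_ , o′ , _) (x≈u , z≈w) =
      x≈u ∷ unique₂ o (opp-resp ≈-refl x≈u z≈w o′) ∷ z≈w ∷ []
    uniqueness₄ 2 _ _ _ _ (suc (suc (suc m))) (s≤s (s≤s ())) _ _ _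
    uniqueness₄ 3 _ _ (t ∷ u ∷ v ∷ w ∷ []) (_ , o₁ , o₂ , _) 0 _ (x ∷ []) _ (x≈t , x≈w) =
      ⊥-elim (adj³⇒≉ (adj-sym (opp⇒adjˡ o₁)) (opp⇒adjʳ o₁) (opp⇒adjʳ o₂) (≈-trans (≈-sym x≈t) x≈w))
    uniqueness₄ 3 _ _ (t ∷ u ∷ v ∷ w ∷ []) (_ , o₁ , o₂ , _) 1 _ (x ∷ y ∷ []) (xy , _) (x≈t , y≈w)
      with either-end {t} {u} {v} {w}
    ... | inj₁ t-pt = ⊥-elim (3-1 t-pt o₁ o₂ (adj-resp x≈t y≈w xy))
    ... | inj₂ f    = ⊥-elim (3-1 (f (adj-sym (opp⇒adjˡ o₁)) (opp⇒adjʳ o₁) (opp⇒adjʳ o₂))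
                                  (opp-sym o₂) (opp-sym o₁) (adj-sym (adj-resp x≈t y≈w xy)))
    uniqueness₄ 3 _ _ (t ∷ u ∷ v ∷ w ∷ []) (_ , o₁ , o₂ , _) 2 _
                (x ∷ y ∷ z ∷ []) (_ , o′ , _) (x≈t , z≈w) =
      ⊥-elim (other-≢ _ (trans (sym (adj²⇒≡ (adj-sym (opp⇒adjˡ o₃)) (opp⇒adjʳ o₃)))
                               (adj³⇒other (adj-sym (opp⇒adjˡ o₁)) (opp⇒adjʳ o₁) (opp⇒adjʳ o₂))))
      where o₃ = opp-resp ≈-refl x≈t z≈w o′
    uniqueness₄ 3 _ _ (t ∷ u ∷ v ∷ w ∷ []) (_ , o₁ , o₂ , _) 3 _
                (x ∷ y ∷ z ∷ r ∷ []) (_ , o₃ , o₄ , _) (x≈t , r≈w)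
      with either-end {t} {u} {v} {w}
    ... | inj₁ t-pt = let y≈u , z≈v = 3-3 t-pt o₁ o₂ (opp-resp ≈-refl x≈t ≈-refl o₃)
                                                      (opp-resp ≈-refl ≈-refl r≈w o₄)
                      in x≈t ∷ y≈u ∷ z≈v ∷ r≈w ∷ []
    ... | inj₂ f    = let z≈v , y≈u = 3-3 (f (adj-sym (opp⇒adjˡ o₁)) (opp⇒adjʳ o₁) (opp⇒adjʳ o₂))
                                          (opp-sym o₂) (opp-sym o₁)
                                          (opp-sym (opp-resp ≈-refl ≈-refl r≈w o₄))
                                          (opp-sym (opp-resp ≈-refl x≈t ≈-refl o₃))
                      in x≈t ∷ y≈u ∷ z≈v ∷ r≈w ∷ []
    uniqueness₄ 3 _ _ _ _ (suc (suc (suc (suc m)))) (s≤s (s≤s (s≤s ()))) _ _ _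

  -- Octagons and straight circuits

  private
    Edge : ∀ {n} → Vec V (suc n) → V → V → Set ℓ
    Edge = EdgeOf G

  -- An octagon z₀, …, z₇ is the vertex sequence of a straight closed 8-path
  -- (z₀, …, z₇, z₀); adjacency follows from opposition.

  Octagon : Vec V 8 → Set ℓ
  Octagon (z₀ ∷ z₁ ∷ z₂ ∷ z₃ ∷ z₄ ∷ z₅ ∷ z₆ ∷ z₇ ∷ []) =
    Opp z₁ z₀ z₂ × Opp z₂ z₁ z₃ × Opp z₃ z₂ z₄ × Opp z₄ z₃ z₅ ×
    Opp z₅ z₄ z₆ × Opp z₆ z₅ z₇ × Opp z₇ z₆ z₀ × Opp z₀ z₇ z₁

  close : Vec V 8 → Vec V 9
  close z = z ∷ʳ head z

  rotate : Vec V 8 → Vec V 8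
  rotate (z₀ ∷ z) = z ∷ʳ z₀

  reflect : Vec V 8 → Vec V 8
  reflect (z₀ ∷ z) = z₀ ∷ reverse z

  rotate-octagon : ∀ z → Octagon z → Octagon (rotate z)
  rotate-octagon (z₀ ∷ z₁ ∷ z₂ ∷ z₃ ∷ z₄ ∷ z₅ ∷ z₆ ∷ z₇ ∷ [])
    (o₁ , o₂ , o₃ , o₄ , o₅ , o₆ , o₇ , o₀) = o₂ , o₃ , o₄ , o₅ , o₆ , o₇ , o₀ , o₁

  reflect-octagon : ∀ z → Octagon z → Octagon (reflect z)
  reflect-octagon (z₀ ∷ z₁ ∷ z₂ ∷ z₃ ∷ z₄ ∷ z₅ ∷ z₆ ∷ z₇ ∷ [])
    (o₁ , o₂ , o₃ , o₄ , o₅ , o₆ , o₇ , o₀) =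
    opp-sym o₇ , opp-sym o₆ , opp-sym o₅ , opp-sym o₄ ,
    opp-sym o₃ , opp-sym o₂ , opp-sym o₁ , opp-sym o₀

  path-in-itself : ∀ {n} (p : Vec V (suc n)) → IsPath G Adj p → IsPath G (Edge p) p
  path-in-itself (u ∷ [])        _               = tt
  path-in-itself (u ∷ v ∷ [])    _               = inj₁ (≈-refl , ≈-refl)
  path-in-itself (u ∷ v ∷ w ∷ p) (_ , u≉w , pp) =
    inj₁ (≈-refl , ≈-refl) , u≉w ,
    IsPath-map (λ e → inj₂ (inj₂ e)) (v ∷ w ∷ p) (path-in-itself (v ∷ w ∷ p) pp)

  edge-∷ʳ : ∀ {n} (p : Vec V (suc n)) → Edge p u v → Edge (p ∷ʳ x) u v
  edge-∷ʳ (y ∷ z ∷ p) (inj₁ e)        = inj₁ e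
  edge-∷ʳ (y ∷ z ∷ p) (inj₂ (inj₁ e)) = inj₂ (inj₁ e)
  edge-∷ʳ (y ∷ z ∷ p) (inj₂ (inj₂ e)) = inj₂ (inj₂ (edge-∷ʳ (z ∷ p) e))

  edge-resp-last : ∀ {n} (p : Vec V n) {x y} → x ≈ y → Edge (p ∷ʳ x) u v → Edge (p ∷ʳ y) u v
  edge-resp-last (z ∷ [])    x≈y (inj₁ (u≈z , v≈x))        = inj₁ (u≈z , ≈-trans v≈x x≈y)
  edge-resp-last (z ∷ [])    x≈y (inj₂ (inj₁ (u≈x , v≈z))) = inj₂ (inj₁ (≈-trans u≈x x≈y , v≈z))
  edge-resp-last (z ∷ t ∷ p) x≈y (inj₁ e)                  = inj₁ e
  edge-resp-last (z ∷ t ∷ p) x≈y (inj₂ (inj₁ e))           = inj₂ (inj₁ e)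
  edge-resp-last (z ∷ t ∷ p) x≈y (inj₂ (inj₂ e))           = inj₂ (inj₂ (edge-resp-last (t ∷ p) x≈y e))

  edge-last : ∀ {n} (p : Vec V n) {y z} →
              u ≈ y × v ≈ z ⊎ u ≈ z × v ≈ y → Edge ((p ∷ʳ y) ∷ʳ z) u v
  edge-last []          (inj₁ e) = inj₁ e
  edge-last []          (inj₂ e) = inj₂ (inj₁ e)
  edge-last (x ∷ [])    e        = inj₂ (inj₂ (edge-last [] e))
  edge-last (x ∷ y ∷ p) e        = inj₂ (inj₂ (edge-last (y ∷ p) e))

  edge-reverse : ∀ {n} (p : Vec V (suc n)) → Edge p u v → Edge (reverse p) u v
  edge-reverse {u = u} {v = v} (y ∷ z ∷ p) e
    rewrite reverse-∷ y (z ∷ p) | reverse-∷ z p with e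
  ... | inj₁ e₁        = edge-last (reverse p) (inj₂ e₁)
  ... | inj₂ (inj₁ e₁) = edge-last (reverse p) (inj₁ e₁)
  ... | inj₂ (inj₂ e₁) =
    edge-∷ʳ (reverse p ∷ʳ z) (subst (λ q → Edge q u v) (reverse-∷ z p) (edge-reverse (z ∷ p) e₁))

  rotate-edge : ∀ z → Edge (close z) u v → Edge (close (rotate z)) u v
  rotate-edge (z₀ ∷ z₁ ∷ z) (inj₁ e)        = edge-last (z₁ ∷ z) (inj₁ e)
  rotate-edge (z₀ ∷ z₁ ∷ z) (inj₂ (inj₁ e)) = edge-last (z₁ ∷ z) (inj₂ e)
  rotate-edge (z₀ ∷ z₁ ∷ z) (inj₂ (inj₂ e)) = edge-∷ʳ ((z₁ ∷ z) ∷ʳ z₀) e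

  reflect-edge : ∀ z → Edge (close z) u v → Edge (close (reflect z)) u v
  reflect-edge z@(_ ∷ _ ∷ _ ∷ _ ∷ _ ∷ _ ∷ _ ∷ _ ∷ []) = edge-reverse (close z)

  edge-start : ∀ {n} (p : Vec V (suc n)) → Edge p u v → Any (u ≈_) p
  edge-start (y ∷ z ∷ p) (inj₁ (u≈y , _))        = here u≈y
  edge-start (y ∷ z ∷ p) (inj₂ (inj₁ (u≈z , _))) = there (here u≈z)
  edge-start (y ∷ z ∷ p) (inj₂ (inj₂ e))         = there (edge-start (z ∷ p) e)

  Begins : Vec V 8 → V → V → Set ℓ
  Begins z u v = u ≈ head z × v ≈ head (tail z)

  -- The octagon z can be renumbered so that it begins with the edge {u , v}, read from u to v.

  Starts : Vec V 8 → V → V → Set (c ⊔ ℓ)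
  Starts z u v = Σ (Vec V 8) λ w →
    Octagon w × Begins w u v × (∀ {s t} → Edge (close z) s t → Edge (close w) s t)

  rotations : ℕ → Vec V 8 → Vec V 8
  rotations zero    z = z
  rotations (suc k) z = rotations k (rotate z)

  starts-after : ∀ k z → Octagon z →
                 Begins (rotations k z) u v ⊎ Begins (rotations k z) v u → Starts z u v
  starts-after zero z oct (inj₁ b) = z , oct , b , λ e → e
  -- Rotation brings the second vertex to the front; reflection fixes it and puts the former first
  -- vertex next.
  starts-after zero z@(_ ∷ _ ∷ _ ∷ _ ∷ _ ∷ _ ∷ _ ∷ _ ∷ []) oct (inj₂ (v≈ , u≈)) =
    reflect (rotate z) , reflect-octagon (rotate z) (rotate-octagon z oct) , (u≈ , v≈) ,
    λ e → reflect-edge (rotate z) (rotate-edge z e)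
  starts-after (suc k) z oct b with starts-after k (rotate z) (rotate-octagon z oct) b
  ... | w , oct′ , b′ , f = w , oct′ , b′ , λ e → f (rotate-edge z e)

  starts-edge : ∀ z → Octagon z → Edge (close z) u v → Starts z u v
  starts-edge {u} {v} z@(_ ∷ _ ∷ _ ∷ _ ∷ _ ∷ _ ∷ _ ∷ _ ∷ []) oct =
    -- One `at k` for each of the eight edges in the nested sum `EdgeOf`; the last function handles
    -- its empty end.
    at 0 (at 1 (at 2 (at 3 (at 4 (at 5 (at 6 (at 7 λ { (lift ()) })))))))
    where
    at : ∀ k {A : Set ℓ} → (A → Starts z u v) →
         (u ≈ head (rotations k z) × v ≈ head (tail (rotations k z))) ⊎
         (u ≈ head (tail (rotations k z)) × v ≈ head (rotations k z)) ⊎ A → Starts z u v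
    at k rest (inj₁ e)                = starts-after k z oct (inj₁ e)
    at k rest (inj₂ (inj₁ (u≈ , v≈))) = starts-after k z oct (inj₂ (v≈ , u≈))
    at k rest (inj₂ (inj₂ e))         = rest e

  module Circuits (uniqueness : Uniqueness G 4) where

    unique₂ : Opp v u w → Opp v′ u w → v′ ≈ v
    unique₂ o o′ with uniqueness 2 (s≤s z≤n) (s≤s (s≤s (s≤s z≤n))) _ (straight₂ o)
                      2 (s≤s (s≤s z≤n)) _ (straight₂ o′) (≈-refl , ≈-refl)
    ... | _ ∷ v′≈v ∷ _ ∷ [] = v′≈v

    unique₃ : Opp v u w → Opp w v x → Opp v′ u w′ → Opp w′ v′ x → v′ ≈ v × w′ ≈ w
    unique₃ o₁ o₂ o₃ o₄
      with uniqueness 3 (s≤s z≤n) (s≤s (s≤s (s≤s (s≤s z≤n)))) _ (straight₃ o₁ o₂)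
           3 (s≤s (s≤s (s≤s z≤n))) _ (straight₃ o₃ o₄) (≈-refl , ≈-refl)
    ... | _ ∷ v′≈v ∷ w′≈w ∷ _ ∷ [] = v′≈v , w′≈w

    -- The vertex `z₁` differs from the seven others, so its only edges in the circuit lead to `z₀`
    -- and `z₂`. Parity and antireflexivity settle all vertices but `z₅`.
    octagon-next : ∀ {z₀ z₁ z₂ z} → Octagon (z₀ ∷ z₁ ∷ z₂ ∷ z) →
                   u ≈ z₀ → v ≈ z₁ → Edge (close (z₀ ∷ z₁ ∷ z₂ ∷ z)) v w → ¬ (u ≈ w) → w ≈ z₂
    octagon-next {u} {v} {w} {z₀} {z₁} {z₂} {z₃ ∷ z₄ ∷ z₅ ∷ z₆ ∷ z₇ ∷ []}
      (o₁ , o₂ , o₃ , o₄ , o₅ , o₆ , o₇ , o₀) u≈z₀ v≈z₁ e u≉w = go e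
      where
      differ : ∀ {z} → ¬ (z₁ ≈ z) → v ≈ z → w ≈ z₂
      differ z₁≉z v≈z = ⊥-elim (z₁≉z (≈-trans (≈-sym v≈z₁) v≈z))

      a₀ = opp⇒adjʳ o₀
      a₁ = opp⇒adjʳ o₁
      a₂ = opp⇒adjʳ o₂
      a₃ = opp⇒adjʳ o₃
      a₇ = opp⇒adjʳ o₇
      a₆ = opp⇒adjʳ o₆

      ≠₀ : ¬ (z₁ ≈ z₀)
      ≠₀ = adj-irrefl (adj-sym a₀)
      ≠₂ = adj-irrefl a₁
      ≠₃ = opp⇒≉ o₂
      ≠₄ = adj³⇒≉ a₁ a₂ a₃
      ≠₆ = adj³⇒≉ (adj-sym a₀) (adj-sym a₇) (adj-sym a₆)
      ≠₇ : ¬ (z₁ ≈ z₇)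
      ≠₇ e = opp⇒≉ o₀ (≈-sym e)
      -- Otherwise the straight 2-paths from `z₁` and from `z₅` to `z₃` coincide, and `z₂` = `z₄`.
      ≠₅ : ¬ (z₁ ≈ z₅)
      ≠₅ e = opp⇒≉ o₃ (unique₂ (opp-sym o₄) (opp-resp ≈-refl e ≈-refl o₂))

      go : Edge (close (z₀ ∷ z₁ ∷ z₂ ∷ z₃ ∷ z₄ ∷ z₅ ∷ z₆ ∷ z₇ ∷ [])) v w → w ≈ z₂
      go (inj₁ (v≈ , _)) = differ ≠₀ v≈
      go (inj₂ (inj₁ (_ , w≈z₀))) = ⊥-elim (u≉w (≈-trans u≈z₀ (≈-sym w≈z₀)))
      go (inj₂ (inj₂ (inj₁ (_ , w≈z₂)))) = w≈z₂
      go (inj₂ (inj₂ (inj₂ (inj₁ (v≈ , _))))) = differ ≠₂ v≈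
      go (inj₂ (inj₂ (inj₂ (inj₂ e)))) = ≥₂ e
        where
        ≥₂ : Edge (z₂ ∷ z₃ ∷ z₄ ∷ z₅ ∷ z₆ ∷ z₇ ∷ z₀ ∷ []) v w → w ≈ z₂
        ≥₂ e with edge-start (z₂ ∷ z₃ ∷ z₄ ∷ z₅ ∷ z₆ ∷ z₇ ∷ z₀ ∷ []) e
        ... | here v≈ = differ ≠₂ v≈
        ... | there (here v≈) = differ ≠₃ v≈
        ... | there (there (here v≈)) = differ ≠₄ v≈
        ... | there (there (there (here v≈))) = differ ≠₅ v≈
        ... | there (there (there (there (here v≈)))) = differ ≠₆ v≈
        ... | there (there (there (there (there (here v≈))))) = differ ≠₇ v≈
        ... | there (there (there (there (there (there (here v≈)))))) = differ ≠₀ v≈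

    octagon-opp : ∀ z → Octagon z → Edge (close z) u v → Edge (close z) v w → ¬ (u ≈ w) → Opp v u w
    octagon-opp z oct uv vw u≉w with starts-edge z oct uv
    ... | _ ∷ _ ∷ _ ∷ zs@(_ ∷ _ ∷ _ ∷ _ ∷ _ ∷ []) , oct′ , (u≈ , v≈) , f =
      opp-resp (≈-sym v≈) (≈-sym u≈) (≈-sym (octagon-next {z = zs} oct′ u≈ v≈ (f vw) u≉w)) (proj₁ oct′)

    octagon⇒straight : ∀ z → Octagon z → ∀ {n} (q : Vec V (suc n)) →
                       IsPath G (Edge (close z)) q → Straight G q
    octagon⇒straight z oct (u ∷ [])        _                 = tt
    octagon⇒straight z oct (u ∷ v ∷ [])    _                 = tt
    octagon⇒straight z oct (u ∷ v ∷ w ∷ q) (uv , u≉w , path) =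
      octagon-opp z oct uv (IsPath-first {E = Edge (close z)} {p = q} path) u≉w ,
      octagon⇒straight z oct (v ∷ w ∷ q) path

    octagon⇒extension :
      ∀ {z₀ z₁ z₂ z₃ z₄ z₅ z₆ z₇} →
      Octagon (z₀ ∷ z₁ ∷ z₂ ∷ z₃ ∷ z₄ ∷ z₅ ∷ z₆ ∷ z₇ ∷ []) →
      Σ (Vec V 9) λ z → StraightCircuit G z ×
        IsPath G (Edge z) (z₀ ∷ z₁ ∷ z₂ ∷ z₃ ∷ z₄ ∷ z₅ ∷ [])
    octagon⇒extension {z₀} {z₁} {z₂} {z₃} {z₄} {z₅} {z₆} {z₇}
      oct@(o₁ , o₂ , o₃ , o₄ , o₅ , o₆ , o₇ , _) =
      close z ,
      ((s≤s (s≤s (s≤s z≤n)) ,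
        proj₁ (straight-∷ o₁ (straight-∷ o₂ (straight-∷ o₃ (straight-∷ o₄ (straight₄ o₅ o₆ o₇))))) ,
        ≈-refl) ,
       octagon⇒straight z oct) ,
      IsPath-map (λ e → edge-∷ʳ (p ∷ʳ z₆ ∷ʳ z₇) (edge-∷ʳ (p ∷ʳ z₆) (edge-∷ʳ p e))) p
        (path-in-itself p (proj₁ (straight-∷ o₁ (straight₄ o₂ o₃ o₄))))
      where
      p = z₀ ∷ z₁ ∷ z₂ ∷ z₃ ∷ z₄ ∷ z₅ ∷ []
      z = z₀ ∷ z₁ ∷ z₂ ∷ z₃ ∷ z₄ ∷ z₅ ∷ z₆ ∷ z₇ ∷ []

    circuit⇒octagon : ∀ {z : Vec V 9} → StraightCircuit G z →
                      Σ (Vec V 8) λ w → Octagon w × (∀ {u v} → Edge z u v → Edge (close w) u v)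
    circuit⇒octagon {z@(z₀ ∷ z₁ ∷ z₂ ∷ z₃ ∷ z₄ ∷ z₅ ∷ z₆ ∷ z₇ ∷ z₈ ∷ [])} ((_ , path , z₀≈z₈) , str)
      with str z (path-in-itself z path)
    ... | o₁ , o₂ , o₃ , o₄ , o₅ , o₆ , o₇ , _ =
      (z₀ ∷ z₁ ∷ z₂ ∷ z₃ ∷ z₄ ∷ z₅ ∷ z₆ ∷ z₇ ∷ []) ,
      (o₁ , o₂ , o₃ , o₄ , o₅ , o₆ , opp-resp ≈-refl ≈-refl (≈-sym z₀≈z₈) o₇ ,
       opp-resp (≈-sym z₀≈z₈) ≈-refl ≈-refl (proj₁ (str (z₇ ∷ z₈ ∷ z₁ ∷ []) (e₇ , z₇≉z₁ , e₀)))) ,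
      edge-resp-last (z₀ ∷ z₁ ∷ z₂ ∷ z₃ ∷ z₄ ∷ z₅ ∷ z₆ ∷ z₇ ∷ []) (≈-sym z₀≈z₈)
      where
      -- Needed for the closing corner to be a path. Otherwise the two halves between `z₁` = `z₇`
      -- and `z₄` are straight 3-paths with the same ends, so that `z₃` = `z₅`.
      z₇≉z₁ : ¬ (z₇ ≈ z₁)
      z₇≉z₁ z₇≈z₁ = opp⇒≉ o₄ (≈-sym (proj₂ (unique₃ o₂ o₃
        (opp-resp ≈-refl z₇≈z₁ ≈-refl (opp-sym o₆)) (opp-sym o₅))))
      e₇ : Edge z z₇ z₈
      e₇ = edge-last (z₀ ∷ z₁ ∷ z₂ ∷ z₃ ∷ z₄ ∷ z₅ ∷ z₆ ∷ []) (inj₁ (≈-refl , ≈-refl))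
      e₀ : Edge z z₈ z₁
      e₀ = inj₁ (≈-sym z₀≈z₈ , ≈-refl)

    -- Once the octagon is renumbered to begin with the first edge of the path, `octagon-next`
    -- forces each further vertex.
    octagon-through : ∀ {z : Vec V 9} {p₀ p₁ p₂ p₃ p₄ p₅} → StraightCircuit G z →
      IsPath G (Edge z) (p₀ ∷ p₁ ∷ p₂ ∷ p₃ ∷ p₄ ∷ p₅ ∷ []) →
      ∃[ p₆ ] ∃[ p₇ ] Octagon (p₀ ∷ p₁ ∷ p₂ ∷ p₃ ∷ p₄ ∷ p₅ ∷ p₆ ∷ p₇ ∷ [])
    octagon-through circuit (e₀ , n₀ , e₁ , n₁ , e₂ , n₂ , e₃ , n₃ , e₄) with circuit⇒octagon circuit
    ... | w , oct , f with starts-edge w oct (f e₀)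
    ...   | z@(z₀ ∷ z₁ ∷ z₂ ∷ z₃ ∷ z₄ ∷ z₅ ∷ z₆ ∷ z₇ ∷ []) ,
            oct₀@(o₁ , o₂ , o₃ , o₄ , o₅ , o₆ , o₇ , o₀) , (≈₀ , ≈₁) , g =
      z₆ , z₇ ,
      opp-resp (≈-sym ≈₁) (≈-sym ≈₀) (≈-sym ≈₂) o₁ ,
      opp-resp (≈-sym ≈₂) (≈-sym ≈₁) (≈-sym ≈₃) o₂ ,
      opp-resp (≈-sym ≈₃) (≈-sym ≈₂) (≈-sym ≈₄) o₃ ,
      opp-resp (≈-sym ≈₄) (≈-sym ≈₃) (≈-sym ≈₅) o₄ ,
      opp-resp (≈-sym ≈₅) (≈-sym ≈₄) ≈-refl o₅ ,
      opp-resp ≈-refl (≈-sym ≈₅) ≈-refl o₆ ,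
      opp-resp ≈-refl ≈-refl (≈-sym ≈₀) o₇ ,
      opp-resp (≈-sym ≈₀) ≈-refl (≈-sym ≈₁) o₀
      where
      oct₁ = rotate-octagon z oct₀
      oct₂ = rotate-octagon (rotate z) oct₁
      oct₃ = rotate-octagon (rotations 2 z) oct₂
      ≈₂ = octagon-next oct₀ ≈₀ ≈₁ (g (f e₁)) n₀
      ≈₃ = octagon-next oct₁ ≈₁ ≈₂ (rotate-edge z (g (f e₂))) n₁
      ≈₄ = octagon-next oct₂ ≈₂ ≈₃ (rotate-edge (rotate z) (rotate-edge z (g (f e₃)))) n₂
      ≈₅ = octagon-next oct₃ ≈₃ ≈₄
             (rotate-edge (rotations 2 z) (rotate-edge (rotate z) (rotate-edge z (g (f e₄))))) n₃

-- A green Veldkamp quadrangle as an incidence geometry: a ◁ x is incidence and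
-- x ≡[ a ] y is opposition of the lines x and y at the point a.  Opposition of
-- points on a line is distinctness, so that it does not appear.

record IncidenceQuadrangle (c ℓ : Level) : Set (lsuc (c ⊔ ℓ)) where
  infix 4 _≐_ _≗_ _◁_ _≡[_]_
  field
    P L    : Set c
    _≐_    : P → P → Set ℓ
    _≗_    : L → L → Set ℓ
    _◁_    : P → L → Set ℓ
    _≡[_]_ : L → P → L → Set ℓ

    ≐-refl  : ∀ {a} → a ≐ a
    ≐-sym   : ∀ {a b} → a ≐ b → b ≐ a
    ≐-trans : ∀ {a b d} → a ≐ b → b ≐ d → a ≐ d
    ≗-refl  : ∀ {x} → x ≗ x
    ◁-resp  : ∀ {a a′ x x′} → a ≐ a′ → x ≗ x′ → a ◁ x → a′ ◁ x′
    ≡-resp  : ∀ {a a′ x x′ y y′} → a ≐ a′ → x ≗ x′ → y ≗ y′ → x ≡[ a ] y → x′ ≡[ a′ ] y′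
    ≡-sym   : ∀ {a x y} → x ≡[ a ] y → y ≡[ a ] x
    ≡⇒≭     : ∀ {a x y} → x ≡[ a ] y → ¬ x ≗ y
    ≡⇒◁ˡ    : ∀ {a x y} → x ≡[ a ] y → a ◁ x
    line-through  : ∀ a → ∃[ x ] a ◁ x
    point-on      : ∀ x → ∃[ a ] a ◁ x
    line-opposite : ∀ {a x y} → a ◁ x → a ◁ y → ∃[ z ] z ≡[ a ] x × z ≡[ a ] y
    third-point   : ∀ {a b x} → a ◁ x → b ◁ x → ∃[ d ] d ◁ x × ¬ d ≐ a × ¬ d ≐ b
    join-unique   : ∀ {a b x y} → ¬ a ≐ b → a ◁ x → b ◁ x → a ◁ y → b ◁ y → x ≗ y
    project-unique : ∀ {a b b′ x x′ y} → a ◁ x → ¬ a ≐ b → x ≡[ b ] y →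
                     a ◁ x′ → ¬ a ≐ b′ → x′ ≡[ b′ ] y → x ≗ x′ × b ≐ b′
    extend : ∀ {a b d x y z} → a ◁ x → ¬ a ≐ b → x ≡[ b ] y → ¬ b ≐ d → y ≡[ d ] z →
             ∃[ e ] ∃[ w ] z ≡[ e ] w × w ≡[ a ] x × ¬ d ≐ e × ¬ e ≐ a
    -- Connectedness as an induction principle: a property that passes between concurrent lines
    -- passes between any two lines.
    connected : (N : L → Set (c ⊔ ℓ)) → (∀ {d y z} → d ◁ y → d ◁ z → N y → N z) →
                ∀ {x y} → N x → N y

module Geometry {c ℓ} (em : ExcludedMiddle (c ⊔ ℓ)) (Q : IncidenceQuadrangle c ℓ) where
  open IncidenceQuadrangle Q

  private
    variable
      a a′ b b′ d e f g l m n p q : P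
      h k r s t u v w x x′ y y′ z : L

  classical : {A : Set (c ⊔ ℓ)} → ¬ ¬ A → A
  classical = decidable-stable em

  decide : (A : Set ℓ) → Dec A
  decide A = map′ lower lift (em {Lift c A})

  ≐? : ∀ a b → Dec (a ≐ b)
  ≐? a b = decide (a ≐ b)

  ≭-sym : ¬ a ≐ b → ¬ b ≐ a
  ≭-sym a≭b b≐a = a≭b (≐-sym b≐a)

  ≡⇒◁ʳ : x ≡[ a ] y → a ◁ y
  ≡⇒◁ʳ o = ≡⇒◁ˡ (≡-sym o)

  other-point : a ◁ x → ∃[ d ] d ◁ x × ¬ d ≐ a
  other-point ax with third-point ax ax
  ... | d , dx , d≭a , _ = d , dx , d≭a

  Coll : P → P → Set (c ⊔ ℓ)
  Coll a b = ∃[ x ] a ◁ x × b ◁ x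

  coll-sym : Coll a b → Coll b a
  coll-sym (x , ax , bx) = x , bx , ax

  coll-respˡ : a ≐ a′ → Coll a b → Coll a′ b
  coll-respˡ a≐a′ (x , ax , bx) = x , ◁-resp a≐a′ ≗-refl ax , bx

  ≐⇒coll : a ≐ b → Coll a b
  ≐⇒coll {a} a≐b with line-through a
  ... | x , ax = x , ax , ◁-resp a≐b ≗-refl ax

  record Root (a : P) (x : L) (b : P) : Set (c ⊔ ℓ) where
    constructor root
    field
      mid     : P
      end     : L
      a◁x     : a ◁ x
      a≭mid   : ¬ a ≐ mid
      bend    : x ≡[ mid ] end
      b≭mid   : ¬ b ≐ mid
      b◁end   : b ◁ end
    mid◁end : mid ◁ end
    mid◁end = ≡⇒◁ʳ bend

  infix 4 _op_

  _op_ : P → P → Set (c ⊔ ℓ)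
  a op b = ∃[ x ] Root a x b

  op-via : a ◁ x → ¬ a ≐ m → x ≡[ m ] y → ¬ b ≐ m → b ◁ y → a op b
  op-via ax a≭m o b≭m by = _ , root _ _ ax a≭m o b≭m by

  op-sym : a op b → b op a
  op-sym (_ , root m y ax a≭m o b≭m by) = op-via by b≭m (≡-sym o) a≭m ax

  op-resp : a ≐ a′ → a op b → a′ op b
  op-resp a≐a′ (x , root m y ax a≭m o b≭m by) =
    op-via (◁-resp a≐a′ ≗-refl ax) (λ a′≐m → a≭m (≐-trans a≐a′ a′≐m)) o b≭m by

  -- The straight 5-path from `b` back along the root to `a` and on to `y` lies in an octagon, whose
  -- other half is a root from `a` along `y` to `b`.
  root-turn : (ρ : Root a x b) → y ≡[ a ] x → Σ (Root a y b) λ σ → Root.end σ ≡[ b ] Root.end ρ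
  root-turn (root m z ax a≭m xmz b≭m bz) yax
    with extend bz b≭m (≡-sym xmz) (≭-sym a≭m) (≡-sym yax)
  ... | e , w , yew , wbz , a≭e , e≭b = root e w (≡⇒◁ˡ yax) a≭e yew (≭-sym e≭b) (≡⇒◁ˡ wbz) , wbz

  root-through : a op b → a ◁ y → Root a y b
  root-through (x , ρ) ay with line-opposite (Root.a◁x ρ) ay
  ... | z , zax , zay = proj₁ (root-turn (proj₁ (root-turn ρ zax)) (≡-sym zay))

  root-unique : (ρ σ : Root a x b) → Root.end ρ ≗ Root.end σ × Root.mid ρ ≐ Root.mid σ
  root-unique (root _ _ _ _ o₁ b≭m bz) (root _ _ _ _ o₂ b≭n bw) =
    project-unique bz b≭m (≡-sym o₁) bw b≭n (≡-sym o₂)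

  root-opposite : (ρ : Root a x b) (σ : Root a y b) → y ≡[ a ] x → Root.end σ ≡[ b ] Root.end ρ
  root-opposite ρ σ yax with root-turn ρ yax
  ... | σ′ , o = ≡-resp ≐-refl (proj₁ (root-unique σ′ σ)) ≗-refl o

  op⇒¬coll : a op b → ¬ Coll a b
  op⇒¬coll ab (x , ax , bx) with root-through ab ax
  ... | root m y _ _ o b≭m by = ≡⇒≭ o (join-unique b≭m bx (≡⇒◁ˡ o) by (≡⇒◁ʳ o))

  -- Compare with the root along `x`. If its middle `n` is not `m`, then `m` is opposite `b`,
  -- although both lie on `y`.
  op⇒straight : a op b → a ◁ x → ¬ a ≐ m → m ◁ x → m ◁ y → ¬ b ≐ m → b ◁ y → x ≡[ m ] y
  op⇒straight {m = m} ab ax a≭m mx my b≭m by with root-through ab ax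
  ... | root n z _ a≭n o b≭n bz with ≐? n m
  ...   | yes n≐m = ≡-resp n≐m ≗-refl
                      (join-unique b≭m bz (◁-resp n≐m ≗-refl (≡⇒◁ʳ o)) by my) o
  ...   | no  n≭m = ⊥-elim (op⇒¬coll (op-via mx (≭-sym n≭m) o b≭n bz) (_ , my , by))

  -- The root from `e` along `x` bends at a point `g`, and every other point of `x` is opposite `a`;
  -- being collinear with `a`, the point `b` is `g`.
  op-off : a op e → e ◁ x → b ◁ x → Coll a b → d ◁ x → ¬ d ≐ b → a op d
  op-off {b = b} ae ex bx ab dx d≭b with root-through (op-sym ae) ex
  ... | root g v _ e≭g xgv a≭g av with ≐? b g
  ...   | yes b≐g = op-via av a≭g (≡-sym xgv) (λ d≐g → d≭b (≐-trans d≐g (≐-sym b≐g))) dx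
  ...   | no  b≭g = ⊥-elim (op⇒¬coll (op-via av a≭g (≡-sym xgv) b≭g bx) ab)

  -- A point e opposite both a and d yields roots from a and from d to e through a common line
  -- on e, and their initial parts meet or form a straight 5-path from a to z.

  project-step : b ◁ y → Coll a b → d ◁ y → d ◁ z → ∃[ e ] e ◁ z × Coll a e
  project-step {b = b} {a = a} {d = d} by ab@(x , ax , bx) dy dz with ≐? a b | ≐? b d
  ... | yes a≐b | _       = _ , dz , _ , ◁-resp (≐-sym a≐b) ≗-refl by , dy
  ... | no  _   | yes b≐d = _ , ◁-resp (≐-sym b≐d) ≗-refl dz , ab
  ... | no  a≭b | no  b≭d with line-opposite bx by
  ...   | w , wbx , wby with other-point (≡⇒◁ˡ wbx)
  ...     | e , ew , e≭b
    with root-through (op-via dy (≭-sym b≭d) (≡-sym wby) e≭b ew) dz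
  ...       | root f w′ _ d≭f zfw′ e≭f ew′
    with root-through (op-via ew e≭b wbx a≭b ax) ew′
  ...         | root g v _ e≭g w′gv a≭g av with ≐? g f
  ...           | yes g≐f = f , ≡⇒◁ˡ zfw′ , v , av , ◁-resp g≐f ≗-refl (≡⇒◁ʳ w′gv)
  ...           | no  g≭f with extend av a≭g (≡-sym w′gv) g≭f (≡-sym zfw′)
  ...             | e′ , w″ , ze′w″ , w″av , _ = e′ , ≡⇒◁ˡ ze′w″ , w″ , ≡⇒◁ˡ w″av , ≡⇒◁ʳ ze′w″

  project : ∀ a x → ∃[ b ] b ◁ x × Coll a b
  project a x with line-through a
  ... | y , ay = connected (λ x → ∃[ b ] b ◁ x × Coll a b)
                   (λ { dy dz (b , by , ab) → project-step by ab dy dz })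
                   (a , ay , ≐⇒coll ≐-refl)

  -- Points that are neither collinear nor opposite

  infix 4 _~_ _⟂_

  _~_ : P → P → Set (c ⊔ ℓ)
  a ~ b = a ≐ b ⊎ (¬ Coll a b × ¬ a op b)

  _⟂_ : P → P → Set (c ⊔ ℓ)
  a ⟂ b = ¬ a ≐ b × Coll a b

  trichotomy : ∀ a b → a ~ b ⊎ a ⟂ b ⊎ a op b
  trichotomy a b with ≐? a b | em {Coll a b} | em {a op b}
  ... | yes a≐b | _      | _      = inj₁ (inj₁ a≐b)
  ... | no  a≭b | yes co | _      = inj₂ (inj₁ (a≭b , co))
  ... | no  _   | no _   | yes ab = inj₂ (inj₂ ab)
  ... | no  _   | no ¬co | no ¬ab = inj₁ (inj₂ (¬co , ¬ab))

  ~-sym : a ~ b → b ~ a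
  ~-sym (inj₁ a≐b)         = inj₁ (≐-sym a≐b)
  ~-sym (inj₂ (¬co , ¬op)) = inj₂ ((λ co → ¬co (coll-sym co)) , (λ o → ¬op (op-sym o)))

  ~-refl : a ~ a
  ~-refl = inj₁ ≐-refl

  op-respʳ : b ≐ b′ → a op b → a op b′
  op-respʳ b≐b′ ab = op-sym (op-resp b≐b′ (op-sym ab))

  coll-respʳ : b ≐ b′ → Coll a b → Coll a b′
  coll-respʳ b≐b′ ab = coll-sym (coll-respˡ b≐b′ (coll-sym ab))

  ~⇒¬op : a ~ b → ¬ a op b
  ~⇒¬op (inj₁ a≐b)       ab = op⇒¬coll ab (≐⇒coll a≐b)
  ~⇒¬op (inj₂ (_ , ¬op)) ab = ¬op ab

  ~∧coll⇒≐ : a ~ b → Coll a b → a ≐ b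
  ~∧coll⇒≐ (inj₁ a≐b)       _  = a≐b
  ~∧coll⇒≐ (inj₂ (¬co , _)) co = ⊥-elim (¬co co)

  -- On a line through `e`, the bend of the root to `a` is collinear with `a` and all other points
  -- are opposite `a`, so none of them can be `b`.
  op∧~⇒¬coll : e op a → a ~ b → ¬ Coll e b
  op∧~⇒¬coll ea (inj₁ a≐b) eb = op⇒¬coll ea (coll-respʳ (≐-sym a≐b) eb)
  op∧~⇒¬coll {b = b} ea (inj₂ (¬co , ¬op)) (w , ew , bw) with root-through ea ew
  ... | root g v _ _ o a≭g av with ≐? b g
  ...   | yes b≐g = ¬co (v , av , ◁-resp (≐-sym b≐g) ≗-refl (≡⇒◁ʳ o))
  ...   | no  b≭g = ¬op (op-via av a≭g (≡-sym o) b≭g bw)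

  private
    -- If the middles differed, the one for `b` would be opposite `a` and collinear with `b`.
    same-projection : a ~ b → f ◁ k → f op a → f op b → (ρ : Root f k a) (σ : Root f k b) →
                      Root.mid ρ ≐ Root.mid σ
    same-projection ab fk fa fb (root n₁ m₁ _ f≭n₁ o₁ a≭n₁ am₁) (root n l _ f≭n o b≭n bl) with ≐? n n₁
    ... | yes n≐n₁ = ≐-sym n≐n₁
    ... | no  n≭n₁ = ⊥-elim (op∧~⇒¬coll
      (op-via (≡⇒◁ˡ o) n≭n₁ o₁ a≭n₁ am₁) ab (l , ≡⇒◁ʳ o , bl))

    -- Here g is collinear with a, b and e, and w ≡[ g ] v makes e opposite a.  Take f opposite a
    -- and b, and a third point a₂ of v; then a₂ ~ b, so that a, b and a₂ all have the same
    -- projection to each line on f.  For a line k other than fg this projection is collinear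
    -- with a₂ although it is opposite a₂ by the bend at a.
    no-fan : a ~ b → e ~ b → a ◁ v → g ◁ v → ¬ a ≐ g → g ◁ u → b ◁ u → ¬ b ≐ g →
             g ◁ w → e ◁ w → ¬ e ≐ g → ¬ w ≡[ g ] v
    no-fan {a} {b} {e} {v} {g} {u} {w} a~b e~b av gv a≭g gu bu b≭g gw ew e≭g wgv
      with line-opposite gu gv
    ... | t , tgu , tgv with other-point (≡⇒◁ˡ tgu) | third-point av gv
    ...   | f , ft , f≭g | a₂ , a₂v , a₂≭a , a₂≭g with line-opposite ft ft
    ...     | k , kft , _ = absurd
      where
      fa = op-via ft f≭g tgv a≭g av
      fb = op-via ft f≭g tgu b≭g bu
      fa₂ = op-via ft f≭g tgv a₂≭g a₂v
      a₂e = op-via a₂v a₂≭g (≡-sym wgv) e≭g ew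
      fk = ≡⇒◁ˡ kft

      -- As `a₂` is opposite `e`, it is not collinear with `b`. If it were opposite `b`, then `v`
      -- and `u` would be opposite at `g`, and `a` would be opposite `b`.
      a₂~b : a₂ ~ b
      a₂~b = inj₂ (op∧~⇒¬coll a₂e e~b , λ a₂b →
        ~⇒¬op a~b (op-via av a≭g (op⇒straight a₂b a₂v a₂≭g gv gu b≭g bu) b≭g bu))

      ρ = root-through fa fk
      ρ₂ = root-through fa₂ fk
      σ = root-through fb fk

      n≐n₂ : Root.mid ρ ≐ Root.mid ρ₂
      n≐n₂ = ≐-trans (same-projection a~b fk fa fb ρ σ) (≐-sym (same-projection a₂~b fk fa₂ fb ρ₂ σ))

      bend-at-a : Root.end ρ ≡[ a ] v
      bend-at-a = root-opposite (root g v ft f≭g tgv a≭g av) ρ kft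

      absurd : ⊥
      absurd = op⇒¬coll
        (op-via (Root.mid◁end ρ) (≭-sym (Root.b≭mid ρ)) bend-at-a a₂≭a a₂v)
        (Root.end ρ₂ , ◁-resp (≐-sym n≐n₂) ≗-refl (Root.mid◁end ρ₂) , Root.b◁end ρ₂)

  opaque
    -- On a line `w` through `e`, a point collinear with `b` must be the bend `g` of the root to
    -- `a`, since the other points are opposite `a`. Then `g` is collinear with all three points,
    -- which `no-fan` excludes.
    ~∧~⇒¬op : a ~ b → b ~ e → ¬ a op e
    ~∧~⇒¬op (inj₁ a≐b) b~e ae = ~⇒¬op b~e (op-resp a≐b ae)
    ~∧~⇒¬op (inj₂ ab) (inj₁ b≐e) ae = proj₂ ab (op-respʳ (≐-sym b≐e) ae)
    ~∧~⇒¬op {a} {b} {e} (inj₂ ab) (inj₂ be) ae with line-through e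
    ... | w , ew with root-through (op-sym ae) ew | project b w
    ...   | root g v _ e≭g wgv a≭g av | d , dw , bd with ≐? d g
    ...     | no d≭g = op∧~⇒¬coll (op-sym (op-via av a≭g (≡-sym wgv) d≭g dw)) (inj₂ ab) (coll-sym bd)
    ...     | yes d≐g with coll-respʳ d≐g bd
    ...       | u , bu , gu = no-fan (inj₂ ab) (~-sym (inj₂ be)) av (≡⇒◁ʳ wgv) a≭g gu bu
      (λ b≐g → proj₁ ab (v , av , ◁-resp (≐-sym b≐g) ≗-refl (≡⇒◁ʳ wgv)))
      (≡⇒◁ˡ wgv) ew e≭g wgv

  opaque
    op-~ : a op e → a ~ b → b op e
    op-~ {a} {e} {b} ae a~b with trichotomy b e
    ... | inj₁ b~e             = ⊥-elim (~∧~⇒¬op a~b b~e ae)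
    ... | inj₂ (inj₁ (_ , co)) = ⊥-elim (op∧~⇒¬coll (op-sym ae) a~b (coll-sym co))
    ... | inj₂ (inj₂ be)       = be

  op-~ʳ : a op e → e ~ d → a op d
  op-~ʳ ae e~d = op-sym (op-~ (op-sym ae) e~d)

  separate : a ⟂ b → ∃[ e ] a op e × Coll b e
  separate (a≭b , x , ax , bx) with line-opposite bx bx
  ... | z , zbx , _ with other-point (≡⇒◁ˡ zbx)
  ...   | e , ez , e≭b = e , op-via ax a≭b (≡-sym zbx) e≭b ez , z , ≡⇒◁ˡ zbx , ez

  opaque
    same-opposites⇒~ : (∀ e → a op e → b op e) → a ~ b
    same-opposites⇒~ {a} {b} f with trichotomy a b
    ... | inj₁ a~b       = a~b
    ... | inj₂ (inj₁ ab) with separate ab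
    ...   | e , ae , be = ⊥-elim (op⇒¬coll (f e ae) be)
    same-opposites⇒~ {a} {b} f | inj₂ (inj₂ ab) = ⊥-elim (op⇒¬coll (f b ab) (≐⇒coll ≐-refl))

  opaque
    ~-trans : a ~ b → b ~ d → a ~ d
    ~-trans a~b b~d = same-opposites⇒~ λ e ae → op-~ (op-~ ae a~b) b~d

  opaque
    ⟂-~ : a ⟂ b → b ~ d → a ⟂ d
    ⟂-~ {a} {b} {d} (a≭b , ab) b~d with trichotomy a d
    ... | inj₁ a~d       = ⊥-elim (a≭b (~∧coll⇒≐ (~-trans a~d (~-sym b~d)) ab))
    ... | inj₂ (inj₁ ad) = ad
    ... | inj₂ (inj₂ ad) = ⊥-elim (op⇒¬coll (op-~ʳ ad (~-sym b~d)) ab)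

  -- Lines through a common point

  infix 4 _⊑[_]_

  _⊑[_]_ : L → P → L → Set (c ⊔ ℓ)
  x ⊑[ a ] y = ∀ z → z ≡[ a ] x → z ≡[ a ] y

  two-coll⇒¬op : b ◁ x → d ◁ x → ¬ d ≐ b → Coll a b → Coll a d → e ◁ x → ¬ a op e
  two-coll⇒¬op bx dx d≭b ab ad ex ae = op⇒¬coll (op-off ae ex bx ab dx d≭b) ad

  -- If v is opposite x but not y at m, choose b on v, a line k opposite both v and y at m, and
  -- q on k; let j on bl be collinear with q.  The point u of jq collinear with p is collinear
  -- with m as well, so that the line um is not opposite x and hence not opposite y at m; but u is
  -- opposite l, because j is the only point of jq collinear with l.

  ⊑-reverse : m ◁ x → m ◁ y → l ◁ y → ¬ l ≐ m → p ◁ x → ¬ p ≐ m → Coll l p →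
              y ⊑[ m ] x → x ⊑[ m ] y
  ⊑-reverse {m} {x} {y} {l} {p} mx my ly l≭m px p≭m lp y⊑x v vmx with decide (v ≡[ m ] y)
  ... | yes vmy = vmy
  ... | no ¬vmy with other-point (≡⇒◁ˡ vmx) | line-opposite (≡⇒◁ˡ vmx) my
  ...   | b , bv , b≭m | k , kmv , kmy with other-point (≡⇒◁ˡ kmv)
  ...     | q , qk , q≭m = ⊥-elim absurd
    where
    mv = ≡⇒◁ˡ vmx
    pb = op-via px p≭m (≡-sym vmx) b≭m bv
    qb = op-via qk q≭m kmv b≭m bv
    ql = op-via qk q≭m kmy l≭m ly
    qp = op-via qk q≭m (y⊑x k kmy) p≭m px

    b⟂l : b ⟂ l
    b⟂l with trichotomy b l
    ... | inj₁ b~l       = ⊥-elim (op⇒¬coll (op-~ʳ pb b~l) (coll-sym lp))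
    ... | inj₂ (inj₁ bl) = bl
    ... | inj₂ (inj₂ bl) = ⊥-elim (¬vmy (op⇒straight bl bv b≭m mv my l≭m ly))

    absurd : ⊥
    absurd with b⟂l
    ... | b≭l , h , bh , lh with root-through (op-sym qb) bh
    ...   | root j s _ b≭j hjs q≭j qs with project p s
    ...     | u , us , pu = go (trichotomy m j) (trichotomy m u)
      where
      jh = ≡⇒◁ˡ hjs
      js = ≡⇒◁ʳ hjs

      pj : p op j
      pj = op-off pb bh lh (coll-sym lp) jh λ j≐l →
        op⇒¬coll ql (s , qs , ◁-resp j≐l ≗-refl js)

      u≭j : ¬ u ≐ j
      u≭j u≐j = op⇒¬coll pj (coll-respʳ u≐j pu)

      ¬mj : ¬ m op j
      ¬mj = two-coll⇒¬op bh lh (≭-sym b≭l) (v , mv , bv) (y , my , ly) jh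

      -- If m ~ j, then `p` is opposite `m`. The line `h` has two points collinear with `m`, so `m`
      -- is not opposite `j`. If m ~ u, then `s` has two points collinear with `l`, although `q` on
      -- it is opposite `l`. If `m` is opposite `u`, then `q` and `j` are two points of `s`
      -- collinear with `m`.
      go : m ~ j ⊎ m ⟂ j ⊎ m op j → m ~ u ⊎ m ⟂ u ⊎ m op u → ⊥
      go (inj₁ m~j)              _ = op⇒¬coll (op-~ʳ pj (~-sym m~j)) (x , px , mx)
      go (inj₂ (inj₂ mj))        _ = ¬mj mj
      go (inj₂ (inj₁ _))         (inj₁ m~u) = two-coll⇒¬op js us u≭j (h , lh , jh)
        (proj₂ (⟂-~ (l≭m , y , ly , my) m~u)) qs (op-sym ql)
      go (inj₂ (inj₁ (_ , mj)))  (inj₂ (inj₂ mu)) =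
        two-coll⇒¬op js qs q≭j mj (k , ≡⇒◁ˡ kmv , qk) us mu
      go (inj₂ (inj₁ _))         (inj₂ (inj₁ (m≭u , z , mz , uz))) =
        op⇒¬coll (op-via uz (≭-sym m≭u) (y⊑x z zmy) p≭m px) (coll-sym pu)
        where
        zmy : z ≡[ m ] y
        zmy = op⇒straight (op-sym (op-off (op-sym ql) qs js (h , lh , jh) us u≭j))
                uz (≭-sym m≭u) mz my l≭m ly

  -- If no point of x is equivalent to m, some line on m opposite y is not opposite the line n
  -- joining m to a point of x, whereas every line opposite n at m is opposite y.

  ⊑⇒points-~ : p ◁ x → p ◁ y → x ⊑[ p ] y → m ◁ y → ∃[ l ] l ~ m × l ◁ x
  ⊑⇒points-~ {p} {x} {y} {m} px py x⊑y my = classical absurd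
    where
    absurd : ¬ ¬ (∃[ l ] l ~ m × l ◁ x)
    absurd none with ≐? m p | line-opposite my my
    ... | yes m≐p | _ = none (p , inj₁ (≐-sym m≐p) , px)
    ... | no  m≭p | v , vmy , _ with other-point (≡⇒◁ˡ vmy)
    ...   | b , bv , b≭m with project b x
    ...     | l , lx , bl = go l⟂m
      where
      p≭m = ≭-sym m≭p
      bp = op-via bv b≭m vmy p≭m py

      l≭p : ¬ l ≐ p
      l≭p l≐p = op⇒¬coll bp (coll-respʳ l≐p bl)

      l⟂m : l ⟂ m
      l⟂m with trichotomy l m
      ... | inj₁ l~m       = ⊥-elim (none (l , l~m , lx))
      ... | inj₂ (inj₁ lm) = lm
      -- Here `y` would be opposite `x` at `p`, hence opposite itself by `x⊑y`.
      ... | inj₂ (inj₂ lm) = ⊥-elim (≡⇒≭ (x⊑y y (≡-sym (op⇒straight lm lx l≭p px py m≭p my))) ≗-refl)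

      go : l ⟂ m → ⊥
      go (l≭m , n , ln , mn) =
        op⇒¬coll (op-via bv b≭m (⊑-reverse my mn ln l≭m py p≭m (x , lx , px) n⊑y v vmy) l≭m ln) bl
        where
        -- A point `e` of `z` is opposite `l`, so it is not equivalent to `p`, and if it is opposite
        -- `p` then `z` is opposite `y`. If `e` and `p` lie on a line `w`, then `w` is opposite `x`
        -- and so `y` at `p`; this makes `e` opposite `m`, but both lie on `z`.
        n⊑y : n ⊑[ m ] y
        n⊑y z zmn with decide (z ≡[ m ] y) | other-point (≡⇒◁ˡ zmn)
        ... | yes zmy | _ = zmy
        ... | no ¬zmy | e , ez , e≭m with trichotomy e p
        ...   | inj₁ e~p = ⊥-elim (op⇒¬coll (op-~ (op-via ez e≭m zmn l≭m ln) e~p) (x , px , lx))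
        ...   | inj₂ (inj₂ ep) =
          ⊥-elim (¬zmy (op⇒straight ep ez e≭m (≡⇒◁ˡ zmn) my p≭m py))
        ...   | inj₂ (inj₁ (e≭p , w , ew , pw)) = ⊥-elim (op⇒¬coll
          (op-via ew e≭p
            (x⊑y w (op⇒straight (op-via ez e≭m zmn l≭m ln) ew e≭p pw px l≭p lx)) m≭p my)
          (z , ez , ≡⇒◁ˡ zmn))

  -- Classes of lines

  infix 4 _◂_ _⌣_ _≍_

  _◂_ : P → L → Set (c ⊔ ℓ)
  a ◂ x = ∃[ b ] b ~ a × b ◁ x

  _⌣_ : L → L → Set (c ⊔ ℓ)
  x ⌣ y = ∃[ p ] ∃[ a ] ∃[ b ]
    p ◁ x × p ◁ y × a ◁ x × b ◁ y × a ~ b × ¬ a ≐ p × ¬ b ≐ p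

  -- One inclusion of point classes is enough; `≍-sym` derives the other.
  _≍_ : L → L → Set (c ⊔ ℓ)
  x ≍ y = ∀ {a} → a ◁ x → a ◂ y

  ◁⇒◂ : a ◁ x → a ◂ x
  ◁⇒◂ ax = _ , ~-refl , ax

  ◂-~ : a ◂ x → a ~ b → b ◂ x
  ◂-~ (d , d~a , dx) a~b = d , ~-trans d~a a~b , dx

  ◂-≍ : a ◂ x → x ≍ y → a ◂ y
  ◂-≍ (d , d~a , dx) x≍y = ◂-~ (x≍y dx) d~a

  ≍-trans : x ≍ y → y ≍ z → x ≍ z
  ≍-trans x≍y y≍z ax = ◂-≍ (x≍y ax) y≍z

  ≗⇒≍ : x ≗ y → x ≍ y
  ≗⇒≍ x≗y ax = ◁⇒◂ (◁-resp ≐-refl x≗y ax)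

  ⌣-sym : x ⌣ y → y ⌣ x
  ⌣-sym (p , a , b , px , py , ax , by , a~b , a≭p , b≭p) =
    p , b , a , py , px , by , ax , ~-sym a~b , b≭p , a≭p

  opaque
    ⌣⇒≍ : x ⌣ y → x ≍ y
    ⌣⇒≍ {x} {y} (p , a , b , px , py , ax , by , a~b , a≭p , b≭p) = ⊑⇒points-~ py px y⊑x
      where
      y⊑x : y ⊑[ p ] x
      y⊑x z zpy with other-point (≡⇒◁ˡ zpy)
      ... | e , ez , e≭p = op⇒straight (op-~ʳ (op-via ez e≭p zpy b≭p by) (~-sym a~b))
                             ez e≭p (≡⇒◁ˡ zpy) px a≭p ax

  opaque
    -- As `a` is collinear with `b` it is collinear with the equivalent point `b′` of `y`. The
    -- joining line `w` meets `x` in `a` and `y` in `b′`.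
    chain : ¬ a ≐ b → a ◁ x → b ◁ x → a ◂ y → b ◂ y → ∃[ w ] x ⌣ w × w ⌣ y
    chain {a} {b} {x} {y} a≭b ax bx (a′ , a′~a , a′y) (b′ , b′~b , b′y)
      with ⟂-~ (a≭b , x , ax , bx) (~-sym b′~b)
    ... | a≭b′ , w , aw , b′w =
      w , (a , b , b′ , ax , aw , bx , b′w , ~-sym b′~b , ≭-sym a≭b , ≭-sym a≭b′) ,
      (b′ , a , a′ , b′w , b′y , aw , a′y , ~-sym a′~a , a≭b′ , λ a′≐b′ →
        a≭b′ (~∧coll⇒≐ (~-trans (~-sym a′~a) (inj₁ a′≐b′)) (w , aw , b′w)))

  ≍-chain : x ≍ y → ∃[ w ] x ⌣ w × w ⌣ y
  ≍-chain {x} x≍y with point-on x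
  ... | a , ax with other-point ax
  ...   | b , bx , b≭a = chain b≭a bx ax (x≍y bx) (x≍y ax)

  opaque
    ≍-sym : x ≍ y → y ≍ x
    ≍-sym x≍y with ≍-chain x≍y
    ... | w , x⌣w , w⌣y = ≍-trans (⌣⇒≍ (⌣-sym w⌣y)) (⌣⇒≍ (⌣-sym x⌣w))

  opaque
    two-common⇒≍ : ¬ a ~ b → a ◂ x → b ◂ x → a ◂ y → b ◂ y → x ≍ y
    two-common⇒≍ ¬a~b (a′ , a′~a , a′x) (b′ , b′~b , b′x) ay by
      with chain (λ a′≐b′ → ¬a~b (~-trans (~-sym a′~a) (~-trans (inj₁ a′≐b′) b′~b)))
             a′x b′x (◂-~ ay (~-sym a′~a)) (◂-~ by (~-sym b′~b))
    ... | w , x⌣w , w⌣y = ≍-trans (⌣⇒≍ x⌣w) (⌣⇒≍ w⌣y)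

  opaque
    -- Incidence of classes is realized at every representative `a` of the point class: a second
    -- point of `x` is collinear with `a` too.
    ◂⇒◁ : a ◂ x → ∃[ w ] w ≍ x × a ◁ w
    ◂⇒◁ {a} {x} (a₀ , a₀~a , a₀x) with other-point a₀x
    ... | b , bx , b≭a₀ with ⟂-~ (b≭a₀ , x , bx , a₀x) a₀~a
    ...   | b≭a , w , bw , aw =
      w , ⌣⇒≍ (b , a , a₀ , bw , bx , aw , a₀x , ~-sym a₀~a , ≭-sym b≭a , ≭-sym b≭a₀) , aw

  -- Opposition at point classes and of line classes

  common-line⇒¬op : a ◂ x → b ◂ x → ¬ a op b
  common-line⇒¬op (a′ , a′~a , a′x) (b′ , b′~b , b′x) ab =
    op⇒¬coll (op-~ (op-~ʳ ab (~-sym b′~b)) (~-sym a′~a)) (_ , a′x , b′x)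

  ~∧◁⇒≐ : a ~ b → a ◁ x → b ◁ x → a ≐ b
  ~∧◁⇒≐ a~b ax bx = ~∧coll⇒≐ a~b (_ , ax , bx)

  Opposite̅ : P → L → L → Set (c ⊔ ℓ)
  Opposite̅ a x y = a ◂ x × a ◂ y × ∃[ d ] ∃[ e ] d ◂ x × e ◂ y × d op e

  opposite̅-intro : x ≡[ b ] y → b ~ a → Opposite̅ a x y
  opposite̅-intro {x} {b} {y} xby b~a with other-point (≡⇒◁ˡ xby) | other-point (≡⇒◁ʳ xby)
  ... | d , dx , d≭b | e , ey , e≭b =
    ◂-~ (◁⇒◂ (≡⇒◁ˡ xby)) b~a , ◂-~ (◁⇒◂ (≡⇒◁ʳ xby)) b~a ,
    d , e , ◁⇒◂ dx , ◁⇒◂ ey , op-via dx d≭b xby e≭b ey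

  opposite̅-resp : a ~ a′ → x ≍ x′ → y ≍ y′ → Opposite̅ a x y → Opposite̅ a′ x′ y′
  opposite̅-resp a~a′ x≍x′ y≍y′ (ax , ay , d , e , dx , ey , de) =
    ◂-≍ (◂-~ ax a~a′) x≍x′ , ◂-≍ (◂-~ ay a~a′) y≍y′ , d , e , ◂-≍ dx x≍x′ , ◂-≍ ey y≍y′ , de

  opposite̅-sym : Opposite̅ a x y → Opposite̅ a y x
  opposite̅-sym (ax , ay , d , e , dx , ey , de) = ay , ax , e , d , ey , dx , op-sym de

  opposite̅⇒¬≍ : Opposite̅ a x y → ¬ x ≍ y
  opposite̅⇒¬≍ (_ , _ , d , e , dx , ey , de) x≍y = common-line⇒¬op (◂-≍ dx x≍y) ey de

  opaque
    opposite̅⇒≡ : Opposite̅ a x y → b ~ a → b ◁ u → u ≍ x → b ◁ v → v ≍ y → u ≡[ b ] v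
    opposite̅⇒≡ (_ , _ , d , e , dx , ey , de) b~a bu u≍x bv v≍y
      with ◂-≍ dx (≍-sym u≍x) | ◂-≍ ey (≍-sym v≍y)
    ... | d′ , d′~d , d′u | e′ , e′~e , e′v =
      op⇒straight d′e′ d′u
        (λ d′≐b → op⇒¬coll d′e′ (_ , ◁-resp (≐-sym d′≐b) ≗-refl bv , e′v)) bu bv
        (λ e′≐b → op⇒¬coll d′e′ (_ , d′u , ◁-resp (≐-sym e′≐b) ≗-refl bu)) e′v
      where
      d′e′ : d′ op e′
      d′e′ = op-~ (op-~ʳ de (~-sym e′~e)) (~-sym d′~d)

  opaque
    opposite̅⇒op : Opposite̅ a x y → d ◂ x → ¬ d ~ a → e ◂ y → ¬ e ~ a → d op e
    opposite̅⇒op o@(ax , ay , _) dx ¬d~a ey ¬e~a with ◂⇒◁ ax | ◂⇒◁ ay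
    ... | u , u≍x , au | v , v≍y , av with ◂-≍ dx (≍-sym u≍x) | ◂-≍ ey (≍-sym v≍y)
    ...   | d′ , d′~d , d′u | e′ , e′~e , e′v = op-~ (op-~ʳ
      (op-via d′u (λ d′≐a → ¬d~a (~-trans (~-sym d′~d) (inj₁ d′≐a)))
        (opposite̅⇒≡ o ~-refl au u≍x av v≍y)
        (λ e′≐a → ¬e~a (~-trans (~-sym e′~e) (inj₁ e′≐a))) e′v) e′~e) d′~d

  opaque
    -- If `b` and `b′` were not equivalent, the bend at `b` would make `a` and `b′` opposite, yet
    -- both belong to `x′`.
    project̅-unique : a ◂ x → ¬ a ~ b → Opposite̅ b x y → a ◂ x′ → ¬ a ~ b′ → Opposite̅ b′ x′ y → b ~ b′
    project̅-unique ax ¬a~b o@(bx , _) ax′ ¬a~b′ (b′x′ , b′y , _) = classical λ ¬b~b′ →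
      common-line⇒¬op ax′ b′x′ (opposite̅⇒op o ax ¬a~b b′y (λ b′~b → ¬b~b′ (~-sym b′~b)))

  opaque
    -- The path of classes is lifted from its middle line `y` outwards: `b₀` and `d₀` on `y`, lines
    -- `x₀` and `z₀` through them, then `a₀` on `x₀`.
    extend̅ : a ◂ x → ¬ a ~ b → Opposite̅ b x y → ¬ b ~ d → Opposite̅ d y z →
              ∃[ e ] ∃[ w ] Opposite̅ e z w × Opposite̅ a w x × ¬ d ~ e × ¬ e ~ a
    extend̅ {a} {x} {b} {y} {d} {z} ax ¬a~b o₁@(bx , (b₀ , b₀~b , b₀y) , _) ¬b~d
            o₂@((d₀ , d₀~d , d₀y) , dz , _)
      with ◂⇒◁ (◂-~ bx (~-sym b₀~b)) | ◂⇒◁ (◂-~ dz (~-sym d₀~d))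
    ... | x₀ , x₀≍x , b₀x₀ | z₀ , z₀≍z , d₀z₀ with ◂-≍ ax (≍-sym x₀≍x)
    ...   | a₀ , a₀~a , a₀x₀
      with extend a₀x₀ (λ a₀≐b₀ → ¬a~b (~-trans (~-sym a₀~a) (~-trans (inj₁ a₀≐b₀) b₀~b)))
             (opposite̅⇒≡ o₁ b₀~b b₀x₀ x₀≍x b₀y ◁⇒◂)
             (λ b₀≐d₀ → ¬b~d (~-trans (~-sym b₀~b) (~-trans (inj₁ b₀≐d₀) d₀~d)))
             (opposite̅⇒≡ o₂ d₀~d d₀y ◁⇒◂ d₀z₀ z₀≍z)
    ...     | e , w , z₀ew , wa₀x₀ , d₀≭e , e≭a₀ =
      e , w , opposite̅-resp ~-refl z₀≍z ◁⇒◂ (opposite̅-intro z₀ew ~-refl) ,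
      opposite̅-resp ~-refl ◁⇒◂ x₀≍x (opposite̅-intro wa₀x₀ a₀~a) ,
      (λ d~e → d₀≭e (~∧◁⇒≐ (~-trans d₀~d d~e) d₀z₀ (≡⇒◁ˡ z₀ew))) ,
      (λ e~a → e≭a₀ (~∧◁⇒≐ (~-trans e~a (~-sym a₀~a)) (≡⇒◁ʳ z₀ew) (≡⇒◁ˡ wa₀x₀)))

  _opᴸ_ : L → L → Set (c ⊔ ℓ)
  x opᴸ y = ∃[ a ] ∃[ w ] ∃[ b ] ¬ a ≐ b × x ≡[ a ] w × w ≡[ b ] y

  opaque
    -- Both end lines are prescribed, hence also `a₀` on `x` and `b₀` on `y`; a line of the class of
    -- `w` has to be found that joins these two points.
    opᴸ-intro : Opposite̅ a x w → ¬ a ~ b → Opposite̅ b w y → x opᴸ y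
    opᴸ-intro {a} {x} {w} {b} {y} o₁@((a₀ , a₀~a , a₀x) , aw , _) ¬a~b o₂@(bw , (b₀ , b₀~b , b₀y) , _)
      with ◂⇒◁ (◂-~ aw (~-sym a₀~a))
    ... | w₀ , w₀≍w , a₀w₀ with ◂-≍ (◂-~ bw (~-sym b₀~b)) (≍-sym w₀≍w)
    ...   | b₁ , b₁~b₀ , b₁w₀
      with ⟂-~ ((λ a₀≐b₁ → ¬a~b (~-trans (~-sym a₀~a) (~-trans (inj₁ a₀≐b₁) (~-trans b₁~b₀ b₀~b))))
               , w₀ , a₀w₀ , b₁w₀) b₁~b₀
    ...     | a₀≭b₀ , w₁ , a₀w₁ , b₀w₁ =
      a₀ , w₁ , b₀ , a₀≭b₀ ,
      opposite̅⇒≡ o₁ a₀~a a₀x ◁⇒◂ a₀w₁ w₁≍w , opposite̅⇒≡ o₂ b₀~b b₀w₁ w₁≍w b₀y ◁⇒◂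
      where
      w₁≍w : w₁ ≍ w
      w₁≍w = ≍-trans (⌣⇒≍ (a₀ , b₀ , b₁ , a₀w₁ , a₀w₀ , b₀w₁ , b₁w₀ , ~-sym b₁~b₀ , ≭-sym a₀≭b₀ ,
        λ b₁≐a₀ → a₀≭b₀ (≐-sym (~∧coll⇒≐ (~-trans (~-sym b₁~b₀) (inj₁ b₁≐a₀)) (w₁ , b₀w₁ , a₀w₁))))) w₀≍w

  opaque
    opᴸ⇒op : y opᴸ z → e ◁ z → ∃[ g ] g ◁ y × g op e
    opᴸ⇒op {e = e} (a , w , b , a≭b , yaw , wbz) ez with ≐? e b
    ... | no  e≭b = a , ≡⇒◁ˡ yaw , op-via (≡⇒◁ʳ yaw) a≭b wbz e≭b ez
    ... | yes e≐b with other-point (≡⇒◁ˡ yaw)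
    ...   | g , gy , g≭a = g , gy , op-via gy g≭a yaw
      (λ e≐a → a≭b (≐-trans (≐-sym e≐a) e≐b)) (◁-resp (≐-sym e≐b) ≗-refl (≡⇒◁ˡ wbz))

  opaque
    opᴸ-from-op : g ◁ x → g op e → ∃[ z ] x opᴸ z × e ◁ z
    opᴸ-from-op gx ge with root-through ge gx
    ... | root m v _ _ xmv e≭m ev with line-opposite ev ev
    ...   | z , zev , _ = z , (m , v , _ , ≭-sym e≭m , xmv , ≡-sym zev) , ≡⇒◁ˡ zev

  opaque
    -- Every point opposite some point of `x` is opposite some point of `y`. If `a` were not in a
    -- class on `y`, it would be collinear with all points of `y`. For the line `w` from `a` to `b`
    -- on `y` this gives `w⊑y`, which reverses and puts `a` in a class on `y` after all.
    opposites⊆⇒≍ : (∀ z → x opᴸ z → y opᴸ z) → x ≍ y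
    opposites⊆⇒≍ {x} {y} hyp {a} ax = classical absurd
      where
      op-some : a′ ◁ x → a′ op e → ∃[ g ] g ◁ y × g op e
      op-some a′x a′e with opᴸ-from-op a′x a′e
      ... | z , xz , ez = opᴸ⇒op (hyp z xz) ez

      ¬op : d ◁ y → ¬ a op d
      ¬op by ab with op-some ax ab
      ... | g , gy , gb = op⇒¬coll gb (y , gy , by)

      collinear : ¬ a ◂ y → d ◁ y → a ⟂ d
      collinear {d} ¬ay dy with trichotomy a d
      ... | inj₁ a~d       = ⊥-elim (¬ay (d , ~-sym a~d , dy))
      ... | inj₂ (inj₁ ad) = ad
      ... | inj₂ (inj₂ ad) = ⊥-elim (¬op dy ad)

      absurd : ¬ ¬ a ◂ y
      absurd ¬ay with point-on y
      ... | b , by with other-point by | collinear ¬ay by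
      ...   | p , py , p≭b | a≭b , w , aw , bw = ¬ay (⊑⇒points-~ by bw
                (⊑-reverse by bw aw a≭b py p≭b (proj₂ (collinear ¬ay py)) w⊑y) aw)
        where
        w⊑y : w ⊑[ b ] y
        w⊑y v vbw with decide (v ≡[ b ] y) | other-point (≡⇒◁ˡ vbw)
        ... | yes vby | _ = vby
        ... | no ¬vby | e , ev , e≭b with op-some ax (op-via aw a≭b (≡-sym vbw) e≭b ev)
        ...   | g , gy , ge = ⊥-elim (¬vby (op⇒straight (op-sym ge) ev e≭b (≡⇒◁ˡ vbw) by
          (λ g≐b → op⇒¬coll ge (v , ◁-resp (≐-sym g≐b) ≗-refl (≡⇒◁ˡ vbw) , ev)) gy))

-- The incidence geometry of a green Veldkamp quadrangle

module Incidence {c ℓ} {Γ : RawVeldkampGraph c ℓ}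
                 {side : RawVeldkampGraph.V Γ → Side} (isQuad : IsGreenVeldkampQuadrangle Γ side) where
  open RawVeldkampGraph Γ
  open IsGreenVeldkampQuadrangle isQuad
  open IsVeldkampPolygon isVeldkampPolygon
  open IsVeldkampGraph isVeldkampGraph
  open IsBipartition isBipartition
  open Classes Γ side using (P; L)
  open VeldkampGraph isVeldkampGraph isBipartition
  open Circuits uniqueness

  -- Wrapped in records so that points and lines can be inferred from their relations.

  infix 4 _≐_ _◁_ _≡[_]_

  record _≐_ {s} (u v : Σ V λ w → side w ≡ s) : Set ℓ where
    constructor equal
    field ≈ : proj₁ u ≈ proj₁ v

  record _◁_ (a : P) (x : L) : Set ℓ where
    constructor incident
    field adj : Adj (proj₁ a) (proj₁ x)

  record _≡[_]_ (x : L) (a : P) (y : L) : Set ℓ where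
    constructor opposite
    field opp : Opp (proj₁ a) (proj₁ x) (proj₁ y)

  private
    variable
      s : Side
      a a′ b b′ d : P
      x x′ y y′ z : L

  ≐-refl : {u : Σ V λ w → side w ≡ s} → u ≐ u
  ≐-refl = equal ≈-refl

  ≐-sym : {u v : Σ V λ w → side w ≡ s} → u ≐ v → v ≐ u
  ≐-sym (equal u≈v) = equal (≈-sym u≈v)

  ≐-trans : {u v w : Σ V λ w → side w ≡ s} → u ≐ v → v ≐ w → u ≐ w
  ≐-trans (equal u≈v) (equal v≈w) = equal (≈-trans u≈v v≈w)

  ◁-resp : a ≐ a′ → x ≐ x′ → a ◁ x → a′ ◁ x′
  ◁-resp (equal p) (equal q) (incident i) = incident (adj-resp p q i)

  ≡-resp : a ≐ a′ → x ≐ x′ → y ≐ y′ → x ≡[ a ] y → x′ ≡[ a′ ] y′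
  ≡-resp (equal p) (equal q) (equal r) (opposite o) = opposite (opp-resp p q r o)

  ≡-sym : x ≡[ a ] y → y ≡[ a ] x
  ≡-sym (opposite o) = opposite (opp-sym o)

  ≡⇒≭ : x ≡[ a ] y → ¬ x ≐ y
  ≡⇒≭ (opposite o) (equal x≈y) = opp⇒≉ o x≈y

  ≡⇒◁ˡ : x ≡[ a ] y → a ◁ x
  ≡⇒◁ˡ (opposite o) = incident (opp⇒adjˡ o)

  line-at : ∀ (a : P) {v} → Adj (proj₁ a) v → side v ≡ line
  line-at (_ , eq) av = trans (adj⇒other av) (cong other eq)

  point-at : ∀ (x : L) {v} → Adj (proj₁ x) v → side v ≡ point
  point-at (_ , eq) xv = trans (adj⇒other xv) (cong other eq)

  green-opp : a ◁ x → b ◁ x → ¬ a ≐ b → Opp (proj₁ x) (proj₁ a) (proj₁ b)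
  green-opp {x = _ , eq} (incident ax) (incident bx) a≭b =
    green _ eq _ _ (adj-sym ax) (adj-sym bx) (λ a≈b → a≭b (equal a≈b))

  opaque
    line-through : ∀ a → ∃[ x ] a ◁ x
    line-through a with 2-plump (proj₁ a) [] [] z≤n
    ... | v , av , _ = (v , line-at a av) , incident av

    point-on : ∀ x → ∃[ a ] a ◁ x
    point-on x with 2-plump (proj₁ x) [] [] z≤n
    ... | v , xv , _ = (v , point-at x xv) , incident (adj-sym xv)

    line-opposite : a ◁ x → a ◁ y → ∃[ z ] z ≡[ a ] x × z ≡[ a ] y
    line-opposite {a} (incident ax) (incident ay)
      with 2-plump (proj₁ a) (_ ∷ _ ∷ []) (ax ∷ ay ∷ []) (s≤s (s≤s z≤n))
    ... | v , av , (o₁ ∷ o₂ ∷ []) =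
      (v , line-at a av) , opposite o₁ , opposite o₂

    third-point : a ◁ x → b ◁ x → ∃[ d ] d ◁ x × ¬ d ≐ a × ¬ d ≐ b
    third-point {a} {x} (incident ax) (incident bx)
      with 2-plump (proj₁ x) (_ ∷ _ ∷ []) (adj-sym ax ∷ adj-sym bx ∷ []) (s≤s (s≤s z≤n))
    ... | v , xv , (o₁ ∷ o₂ ∷ []) = (v , point-at x xv) , incident (adj-sym xv) ,
      (λ { (equal v≈a) → opp⇒≉ o₁ v≈a }) , (λ { (equal v≈b) → opp⇒≉ o₂ v≈b })

    join-unique : ¬ a ≐ b → a ◁ x → b ◁ x → a ◁ y → b ◁ y → x ≐ y
    join-unique a≭b ax bx ay by = equal (unique₂ (green-opp ay by a≭b) (green-opp ax bx a≭b))

    project-unique : a ◁ x → ¬ a ≐ b → x ≡[ b ] y → a ◁ x′ → ¬ a ≐ b′ → x′ ≡[ b′ ] y →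
                     x ≐ x′ × b ≐ b′
    project-unique ax a≭b o@(opposite o₁) ax′ a≭b′ o′@(opposite o₂)
      with unique₃ (green-opp ax′ (≡⇒◁ˡ o′) a≭b′) o₂ (green-opp ax (≡⇒◁ˡ o) a≭b) o₁
    ... | x≈x′ , b≈b′ = equal x≈x′ , equal b≈b′

    extend : a ◁ x → ¬ a ≐ b → x ≡[ b ] y → ¬ b ≐ d → y ≡[ d ] z →
             ∃[ e ] ∃[ w ] z ≡[ e ] w × w ≡[ a ] x × ¬ d ≐ e × ¬ e ≐ a
    extend {a} {x} {b} {y} {d} {z} ax a≭b o₁@(opposite xby) b≭d o₂@(opposite ydz)
      with extension _ (straight-∷ (green-opp ax (≡⇒◁ˡ o₁) a≭b) (straight-∷ xby
             (straight₃ (green-opp (≡⇒◁ˡ (≡-sym o₁)) (≡⇒◁ˡ o₂) b≭d) ydz)))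
    ... | _ , circuit , path with octagon-through circuit path
    ...   | e , w , _ , _ , _ , _ , dze , zew , ewa , wax =
      E , W , opposite zew , opposite wax ,
      (λ { (equal d≈e) → opp⇒≉ dze d≈e }) , (λ { (equal e≈a) → opp⇒≉ ewa e≈a })
      where
      E : P
      E = e , point-at z (opp⇒adjʳ dze)
      W : L
      W = w , line-at E (opp⇒adjʳ zew)

    connected-lines : (N : L → Set (c ⊔ ℓ)) → (∀ {d y z} → d ◁ y → d ◁ z → N y → N z) →
                      ∀ {x y} → N x → N y
    connected-lines N step {x} {y} Nx with connected (proj₁ x) (proj₁ y)
    ... | _ , path , isPath , ≈x , ≈y = proj₁ (near-path path isPath near-start) y ≈y
      where
      -- The invariant along a path that alternates lines and points: at a point, `N` holds for all
      -- lines through it.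
      Near : V → Set (c ⊔ ℓ)
      Near v = (∀ z → v ≈ proj₁ z → N z) × (∀ d z → v ≈ proj₁ d → d ◁ z → N z)

      near-step : ∀ {u v} → Adj u v → Near u → Near v
      near-step {u} {v} uv (near-line , near-point) = to-line , to-point
        where
        to-line : ∀ z → v ≈ proj₁ z → N z
        to-line z v≈z = near-point (u , point-at z zu) z ≈-refl (incident (adj-sym zu))
          where
          zu : Adj (proj₁ z) u
          zu = adj-sym (adj-resp ≈-refl v≈z uv)
        to-point : ∀ d z → v ≈ proj₁ d → d ◁ z → N z
        to-point d z v≈d dz = step (incident du) dz (near-line (u , line-at d du) ≈-refl)
          where
          du : Adj (proj₁ d) u
          du = adj-sym (adj-resp ≈-refl v≈d uv)

      near-path : ∀ {n} (p : Vec V (suc n)) → IsPath Γ Adj p → Near (head p) → Near (last p)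
      near-path (u ∷ [])    _    near = near
      near-path (u ∷ v ∷ p) path near =
        near-path (v ∷ p) (IsPath-tail {E = Adj} {p = v ∷ p} path)
          (near-step (IsPath-first {E = Adj} {p = p} path) near)

      near-start : Near (head path)
      near-start = start , λ d z ≈d dz → ⊥-elim (point≢line
        (trans (sym (proj₂ d)) (trans (sym (side-resp ≈d)) (trans (side-resp ≈x) (proj₂ x)))))
        where
        point≢line : ¬ (point ≡ line)
        point≢line ()
        start : ∀ z → head path ≈ proj₁ z → N z
        start z ≈z with point-on x
        ... | a , ax = step ax (◁-resp ≐-refl (equal (≈-trans (≈-sym ≈x) ≈z)) ax) Nx

  geometry : IncidenceQuadrangle c ℓ
  geometry = record
    { P = P ; L = L ; _≐_ = _≐_ ; _≗_ = _≐_ ; _◁_ = _◁_ ; _≡[_]_ = _≡[_]_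
    ; ≐-refl = ≐-refl ; ≐-sym = ≐-sym ; ≐-trans = ≐-trans ; ≗-refl = ≐-refl
    ; ◁-resp = ◁-resp ; ≡-resp = ≡-resp ; ≡-sym = ≡-sym ; ≡⇒≭ = ≡⇒≭ ; ≡⇒◁ˡ = ≡⇒◁ˡ
    ; line-through = line-through ; point-on = point-on ; line-opposite = line-opposite
    ; third-point = third-point ; join-unique = join-unique ; project-unique = project-unique
    ; extend = extend ; connected = connected-lines
    }

data ClassOf {c ℓ} (Γ : RawVeldkampGraph c ℓ) (side : RawVeldkampGraph.V Γ → Side)
             (v : RawVeldkampGraph.V Γ) : Classes.V̄ Γ side → Set c where
  is-point : ∀ v-pt → ClassOf Γ side v (inj₁ (v , v-pt))
  is-line  : ∀ v-ln → ClassOf Γ side v (inj₂ (v , v-ln))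

-- toClass branches on side v together with a proof about side v, so that abstracting
-- side v everywhere is ill-typed.  As t and t′ are convertible but syntactically
-- different, the occurrence of side v in the type of the proof is left alone.

classOf : ∀ {c ℓ} (Γ : RawVeldkampGraph c ℓ) (side : ⊤ → RawVeldkampGraph.V Γ → Side) (t t′ : ⊤) →
          ∀ v → ClassOf Γ (side t) v (Classes.toClass Γ (side t) v)
classOf Γ side t t′ v with side t v | ((side t′ v ≡ side t v) ∋ refl)
... | point | v-pt = is-point v-pt
... | line  | v-ln = is-line v-ln

-- The graph of classes

module Quotient {c ℓ} (em : ExcludedMiddle (c ⊔ ℓ)) {Γ : RawVeldkampGraph c ℓ}
                {side : RawVeldkampGraph.V Γ → Side} (isQuad : IsGreenVeldkampQuadrangle Γ side) where
  open RawVeldkampGraph Γ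
  open IsGreenVeldkampQuadrangle isQuad
  open IsVeldkampPolygon isVeldkampPolygon using (isVeldkampGraph; uniqueness)
  open IsVeldkampGraph isVeldkampGraph
  open IsBipartition isBipartition
  open VeldkampGraph isVeldkampGraph isBipartition
  open Classes Γ side
  open Incidence isQuad
  open Geometry em geometry

  point≢line : ¬ (point ≡ line)
  point≢line ()

  point-line-≉ : ∀ {u v} → side u ≡ point → side v ≡ line → ¬ (u ≈ v)
  point-line-≉ u-pt v-ln u≈v = point≢line (trans (sym u-pt) (trans (side-resp u≈v) v-ln))

  -- The relations on vertices of Γ and their incidence-geometric counterparts

  weed : ∀ {a x m y b} → ¬ Coll a b → ¬ a op b → a ◁ x → m ◁ x → m ◁ y → b ◁ y →
         IsWeed (proj₁ a) (proj₁ x) (proj₁ m) (proj₁ y) (proj₁ b)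
  weed {a} {x} {m} {y} {b} ¬co ¬op ax mx my by =
    path , ¬straight , (proj₂ a , proj₂ m , proj₂ b) ,
    (w , path , ≈-refl , ≈-refl) , at-least-4
    where
    w = proj₁ a ∷ proj₁ x ∷ proj₁ m ∷ proj₁ y ∷ proj₁ b ∷ []

    a≭m : ¬ a ≐ m
    a≭m a≐m = ¬co (y , ◁-resp (≐-sym a≐m) ≐-refl my , by)

    m≭b : ¬ m ≐ b
    m≭b m≐b = ¬co (x , ax , ◁-resp m≐b ≐-refl mx)

    path : IsPath Γ Adj w
    path = _◁_.adj ax , (λ e → a≭m (equal e)) , adj-sym (_◁_.adj mx) ,
      (λ x≈y → ¬co (y , ◁-resp ≐-refl (equal x≈y) ax , by)) , _◁_.adj my ,
      (λ e → m≭b (equal e)) , adj-sym (_◁_.adj by)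

    ¬straight : ¬ Straight Γ w
    ¬straight (_ , xmy , _) = ¬op (op-via ax a≭m (opposite xmy) (λ b≐m → m≭b (≐-sym b≐m)) by)

    same-side : ∀ {u v} → u ≈ proj₁ a → v ≈ proj₁ b → side u ≡ side v
    same-side u≈a v≈b =
      trans (trans (side-resp u≈a) (proj₂ a)) (sym (trans (side-resp v≈b) (proj₂ b)))

    at-least-4 : ∀ s → PathOfLength Γ s (proj₁ a) (proj₁ b) → 4 ≤ s
    at-least-4 0 (u ∷ [] , _ , u≈a , u≈b) =
      ⊥-elim (¬co (≐⇒coll (equal (≈-trans (≈-sym u≈a) u≈b))))
    at-least-4 1 (u ∷ v ∷ [] , uv , u≈a , v≈b) = ⊥-elim (side-adj uv (same-side u≈a v≈b))
    at-least-4 2 (u ∷ v ∷ w ∷ [] , (uv , _ , vw) , u≈a , w≈b) =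
      ⊥-elim (¬co ((v , line-at a av) , incident av , incident (adj-sym (adj-resp ≈-refl w≈b vw))))
      where av = adj-resp u≈a ≈-refl uv
    at-least-4 3 (t ∷ u ∷ v ∷ w ∷ [] , (tu , _ , uv , _ , vw) , t≈a , w≈b) =
      ⊥-elim (other-≢ _ (trans (same-side t≈a w≈b) (adj³⇒other tu uv vw)))
    at-least-4 (suc (suc (suc (suc s)))) _ = s≤s (s≤s (s≤s (s≤s z≤n)))

  weed⇒~ : ∀ {a x m y b} (a-pt : side a ≡ point) (b-pt : side b ≡ point) →
           IsWeed a x m y b → (a , a-pt) ~ (b , b-pt)
  weed⇒~ {a} {x} {m} {y} {b} a-pt b-pt
         ((ax , a≉m , xm , x≉y , my , m≉b , yb) , ¬straight , _ , _ , min) = inj₂ (¬co , ¬op)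
    where
    A B M : P
    A = a , a-pt
    B = b , b-pt
    X Y : L
    X = x , line-at A ax
    M = m , point-at X xm
    Y = y , line-at M my

    ¬co : ¬ Coll A B
    ¬co ((z , _) , incident az , incident bz) with decide (a ≈ b)
    ... | no  a≉b with min 2 (a ∷ z ∷ b ∷ [] , (az , a≉b , adj-sym bz) , ≈-refl , ≈-refl)
    ...   | s≤s (s≤s ())
    ¬co _ | yes a≈b with min 0 (a ∷ [] , tt , ≈-refl , a≈b)
    ...   | ()

    A◁X : A ◁ X
    A◁X = incident ax
    M◁X : M ◁ X
    M◁X = incident (adj-sym xm)
    M◁Y : M ◁ Y
    M◁Y = incident my
    B◁Y : B ◁ Y
    B◁Y = incident (adj-sym yb)
    A≭M : ¬ A ≐ M
    A≭M (equal e) = a≉m e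
    M≭B : ¬ M ≐ B
    M≭B (equal e) = m≉b e

    ¬op : ¬ A op B
    ¬op ab = ¬straight (green-opp A◁X M◁X A≭M ,
      _≡[_]_.opp (op⇒straight ab A◁X A≭M M◁X M◁Y (≭-sym M≭B) B◁Y) ,
      green-opp M◁Y B◁Y M≭B , tt)

  ≃⇒~ : ∀ {a b} → a ≃ b → a ~ b
  ≃⇒~ (inj₁ a≈b)               = inj₁ (equal a≈b)
  ≃⇒~ {a} {b} (inj₂ (_ , _ , _ , w)) = weed⇒~ (proj₂ a) (proj₂ b) w

  ~⇒≃ : ∀ {a b} → a ~ b → a ≃ b
  ~⇒≃ (inj₁ (equal a≈b)) = inj₁ a≈b
  ~⇒≃ {a} {b} (inj₂ (¬co , ¬op)) with line-through b
  -- Projecting `a` to a line through `b` supplies the 4-path of the weed.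
  ... | y , by with project a y
  ...   | m , my , x , ax , mx = inj₂ (proj₁ x , proj₁ m , proj₁ y , weed ¬co ¬op ax mx my by)

  ∼⇒≍ : ∀ {x y} → x ∼ y → x ≍ y
  ∼⇒≍ {x} {y} (a , u , b , v , d , w@((au , a≉b , ub , _ , bv , b≉d , vd) , _ , (a-pt , b-pt , d-pt) , _) ,
               x∈w , y∈w) =
    ≍-trans (to-u x∈w) (from-u y∈w)
    where
    A B D : P
    A = a , a-pt
    B = b , b-pt
    D = d , d-pt
    U W : L
    U = u , line-at A au
    W = v , line-at B bv

    U⌣W : U ⌣ W
    U⌣W = B , A , D , incident (adj-sym ub) , incident bv , incident au , incident (adj-sym vd) ,
      weed⇒~ a-pt d-pt w , (λ { (equal e) → a≉b e }) , (λ { (equal e) → b≉d (≈-sym e) })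

    line-of : (z : L) → Any (proj₁ z ≈_) (a ∷ u ∷ b ∷ v ∷ d ∷ []) → z ≐ U ⊎ z ≐ W
    line-of z (here z≈a)                         = ⊥-elim (point-line-≉ a-pt (proj₂ z) (≈-sym z≈a))
    line-of z (there (here z≈u))                 = inj₁ (equal z≈u)
    line-of z (there (there (here z≈b)))         = ⊥-elim (point-line-≉ b-pt (proj₂ z) (≈-sym z≈b))
    line-of z (there (there (there (here z≈v)))) = inj₂ (equal z≈v)
    line-of z (there (there (there (there (here z≈d))))) =
      ⊥-elim (point-line-≉ d-pt (proj₂ z) (≈-sym z≈d))

    to-u : Any (proj₁ x ≈_) (a ∷ u ∷ b ∷ v ∷ d ∷ []) → x ≍ U
    to-u x∈w with line-of x x∈w
    ... | inj₁ x≐U = ≗⇒≍ x≐U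
    ... | inj₂ x≐W = ≍-trans (≗⇒≍ x≐W) (⌣⇒≍ (⌣-sym U⌣W))

    from-u : Any (proj₁ y ≈_) (a ∷ u ∷ b ∷ v ∷ d ∷ []) → U ≍ y
    from-u y∈w with line-of y y∈w
    ... | inj₁ y≐U = ≗⇒≍ (≐-sym y≐U)
    ... | inj₂ y≐W = ≍-trans (⌣⇒≍ U⌣W) (≗⇒≍ (≐-sym y≐W))

  ≋⇒≍ : ∀ {x y} → x ≋ y → x ≍ y
  ≋⇒≍ ε                = ◁⇒◂
  ≋⇒≍ (inj₁ x≈y ◅ y≋z) = ≍-trans (≗⇒≍ (equal x≈y)) (≋⇒≍ y≋z)
  ≋⇒≍ (inj₂ x∼y ◅ y≋z) = ≍-trans (∼⇒≍ x∼y) (≋⇒≍ y≋z)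

  ≐⇒≋ : ∀ {x y : L} → x ≐ y → x ≋ y
  ≐⇒≋ (equal x≈y) = inj₁ x≈y ◅ ε

  ⌣⇒≋ : ∀ {x y} → x ⌣ y → x ≋ y
  ⌣⇒≋ {x} {y} (p , a , b , px , py , ax , by , inj₁ a≐b , a≭p , _) =
    ≐⇒≋ (join-unique a≭p ax px (◁-resp (≐-sym a≐b) ≐-refl by) py)
  ⌣⇒≋ {x} {y} (p , a , b , px , py , ax , by , inj₂ (¬co , ¬op) , _ , _) =
    inj₂ (_ , _ , _ , _ , _ , weed ¬co ¬op ax px py by ,
          there (here ≈-refl) , there (there (there (here ≈-refl)))) ◅ ε

  ≍⇒≋ : ∀ {x y} → x ≍ y → x ≋ y
  ≍⇒≋ x≍y with ≍-chain x≍y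
  ... | w , x⌣w , w⌣y = ⌣⇒≋ x⌣w ◅◅ ⌣⇒≋ w⌣y

  ≃-refl : ∀ {a} → a ≃ a
  ≃-refl = inj₁ ≈-refl

  incident⇒◂ : ∀ {a x} → Incident a x → a ◂ x
  incident⇒◂ (a′ , x′ , a′≃a , x′≋x , adj) = ◂-≍ (◂-~ a′x′ (≃⇒~ a′≃a)) (≋⇒≍ x′≋x)
    where
    a′x′ : a′ ◂ x′
    a′x′ = ◁⇒◂ (incident adj)

  ◂⇒incident : ∀ {a x} → a ◂ x → Incident a x
  ◂⇒incident (b , b~a , incident bx) = b , _ , ~⇒≃ b~a , ε , bx

  data OppositionIn̅ : V̄ → V̄ → V̄ → Set (c ⊔ ℓ) where
    at-line  : ∀ {x a b} → a ◂ x → b ◂ x → ¬ a ~ b → OppositionIn̅ (inj₂ x) (inj₁ a) (inj₁ b)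
    at-point : ∀ {a x y} → Opposite̅ a x y → OppositionIn̅ (inj₁ a) (inj₂ x) (inj₂ y)

  from-opp̄ : ∀ v u w → Opp̄ v u w → OppositionIn̅ v u w
  from-opp̄ (inj₂ x) (inj₁ a) (inj₁ b) (ax , bx , ¬a≃b) =
    at-line (incident⇒◂ ax) (incident⇒◂ bx) (λ a~b → ¬a≃b (~⇒≃ a~b))
  from-opp̄ (inj₁ a) (inj₂ x) (inj₂ y) (ax , ay , b , b≃a , f)
    -- The condition at `b` is universal, so lines of both classes through `b` itself are needed to
    -- make use of it.
    with ◂⇒◁ (◂-~ (incident⇒◂ {a} ax) (~-sym (≃⇒~ {b} {a} b≃a)))
       | ◂⇒◁ (◂-~ (incident⇒◂ {a} ay) (~-sym (≃⇒~ {b} {a} b≃a)))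
  ... | u , u≍x , incident bu | v , v≍y , incident bv = at-point
    (opposite̅-resp ~-refl u≍x v≍y
      (opposite̅-intro (opposite {x = u} {b} {v} (f u v bu (≍⇒≋ u≍x) bv (≍⇒≋ v≍y))) (≃⇒~ {b} {a} b≃a)))
  from-opp̄ (inj₂ _) (inj₁ _) (inj₂ _) (lift ())
  from-opp̄ (inj₂ _) (inj₂ _) _        (lift ())
  from-opp̄ (inj₁ _) (inj₂ _) (inj₁ _) (lift ())
  from-opp̄ (inj₁ _) (inj₁ _) _        (lift ())

  to-opp̄ : ∀ {v u w} → OppositionIn̅ v u w → Opp̄ v u w
  to-opp̄ (at-line ax bx ¬a~b)        = ◂⇒incident ax , ◂⇒incident bx , λ a≃b → ¬a~b (≃⇒~ a≃b)
  to-opp̄ (at-point {a} o@(ax , ay , _)) = ◂⇒incident ax , ◂⇒incident ay , a , ≃-refl {a} ,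
    λ u v au u≋x av v≋y →
      _≡[_]_.opp (opposite̅⇒≡ o ~-refl (incident au) (≋⇒≍ u≋x) (incident av) (≋⇒≍ v≋y))

  infix 4 _≈̄_

  _≈̄_ : V̄ → V̄ → Set (c ⊔ ℓ)
  _≈̄_ = Sum.Pointwise _≃_ _≋_

  ≈̄-point : ∀ {a b} → a ~ b → inj₁ a ≈̄ inj₁ b
  ≈̄-point a~b = Sum.inj₁ (~⇒≃ a~b)

  ≈̄-line : ∀ {x y} → x ≍ y → inj₂ x ≈̄ inj₂ y
  ≈̄-line x≍y = Sum.inj₂ (≍⇒≋ x≍y)

  from-≈̄-point : ∀ {a b} → inj₁ a ≈̄ inj₁ b → a ~ b
  from-≈̄-point {a} {b} (Sum.inj₁ a≃b) = ≃⇒~ {a} {b} a≃b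

  from-≈̄-line : ∀ {x y} → inj₂ x ≈̄ inj₂ y → x ≍ y
  from-≈̄-line (Sum.inj₂ x≋y) = ≋⇒≍ x≋y

  ≈̄-isEquivalence : IsEquivalence _≈̄_
  ≈̄-isEquivalence = record
    { refl  = λ { {inj₁ a} → ≈̄-point ~-refl ; {inj₂ x} → ≈̄-line ◁⇒◂ }
    ; sym   = λ { {inj₁ _} {inj₁ _} e → ≈̄-point (~-sym (from-≈̄-point e))
                ; {inj₂ _} {inj₂ _} e → ≈̄-line (≍-sym (from-≈̄-line e))
                ; {inj₁ _} {inj₂ _} () ; {inj₂ _} {inj₁ _} () }
    ; trans = λ { {inj₁ _} {inj₁ _} {inj₁ _} e f → ≈̄-point (~-trans (from-≈̄-point e) (from-≈̄-point f))
                ; {inj₂ _} {inj₂ _} {inj₂ _} e f → ≈̄-line (≍-trans (from-≈̄-line e) (from-≈̄-line f))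
                ; {inj₁ _} {inj₂ _} () ; {inj₂ _} {inj₁ _} ()
                ; {inj₁ _} {inj₁ _} {inj₂ _} _ () ; {inj₂ _} {inj₂ _} {inj₁ _} _ () }
    }

  incident-resp : ∀ {a b x y} → inj₁ a ≈̄ inj₁ b → inj₂ x ≈̄ inj₂ y → Incident a x → Incident b y
  incident-resp {a} e f ax =
    ◂⇒incident (◂-≍ (◂-~ (incident⇒◂ {a} ax) (from-≈̄-point e)) (from-≈̄-line f))

  adj̄-resp : ∀ {u u′ v v′} → u ≈̄ u′ → v ≈̄ v′ → Adj̄ u v → Adj̄ u′ v′
  adj̄-resp {inj₁ a} {inj₁ b} {inj₂ x} {inj₂ y} e f ax = incident-resp e f ax
  adj̄-resp {inj₂ x} {inj₂ y} {inj₁ a} {inj₁ b} f e ax = incident-resp e f ax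
  adj̄-resp {inj₁ _} {inj₁ _} {inj₁ _} _ _ (lift ())
  adj̄-resp {inj₂ _} {inj₂ _} {inj₂ _} _ _ (lift ())
  adj̄-resp {inj₁ _} {inj₂ _} ()
  adj̄-resp {inj₂ _} {inj₁ _} ()
  adj̄-resp {v = inj₁ _} {inj₂ _} _ ()
  adj̄-resp {v = inj₂ _} {inj₁ _} _ ()

  adj̄-sym : ∀ {u v} → Adj̄ u v → Adj̄ v u
  adj̄-sym {inj₁ _} {inj₂ _} ax = ax
  adj̄-sym {inj₂ _} {inj₁ _} ax = ax
  adj̄-sym {inj₁ _} {inj₁ _} (lift ())
  adj̄-sym {inj₂ _} {inj₂ _} (lift ())

  adj̄⇒≢ : ∀ {u v} → Adj̄ u v → ¬ (classSide u ≡ classSide v)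
  adj̄⇒≢ {inj₁ _} {inj₂ _} _ ()
  adj̄⇒≢ {inj₂ _} {inj₁ _} _ ()
  adj̄⇒≢ {inj₁ _} {inj₁ _} (lift ())
  adj̄⇒≢ {inj₂ _} {inj₂ _} (lift ())

  classSide-resp : ∀ {u v} → u ≈̄ v → classSide u ≡ classSide v
  classSide-resp (Sum.inj₁ _) = refl
  classSide-resp (Sum.inj₂ _) = refl

  opp̄-resp : ∀ {v v′ u u′ w w′} → v ≈̄ v′ → u ≈̄ u′ → w ≈̄ w′ → Opp̄ v u w → Opp̄ v′ u′ w′
  opp̄-resp {v} {v′} {u} {u′} {w} {w′} e f g o = to-opp̄ (resp e f g (from-opp̄ v u w o))
    where
    resp : ∀ {v v′ u u′ w w′} → v ≈̄ v′ → u ≈̄ u′ → w ≈̄ w′ →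
           OppositionIn̅ v u w → OppositionIn̅ v′ u′ w′
    resp e@(Sum.inj₂ _) f@(Sum.inj₁ _) g@(Sum.inj₁ _) (at-line ax bx ¬a~b) = at-line
      (◂-≍ (◂-~ ax (from-≈̄-point f)) (from-≈̄-line e)) (◂-≍ (◂-~ bx (from-≈̄-point g)) (from-≈̄-line e))
      λ a′~b′ → ¬a~b (~-trans (from-≈̄-point f) (~-trans a′~b′ (~-sym (from-≈̄-point g))))
    resp e@(Sum.inj₁ _) f@(Sum.inj₂ _) g@(Sum.inj₂ _) (at-point o) =
      at-point (opposite̅-resp (from-≈̄-point e) (from-≈̄-line f) (from-≈̄-line g) o)

  opposition-sym : ∀ {v u w} → OppositionIn̅ v u w → OppositionIn̅ v w u
  opposition-sym (at-line ax bx ¬a~b) = at-line bx ax (λ b~a → ¬a~b (~-sym b~a))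
  opposition-sym (at-point o)         = at-point (opposite̅-sym o)

  opposition̅ : ∀ v → IsOpposition _≈̄_ (Adj̄ v) (Opp̄ v)
  opposition̅ v = record
    { domain   = λ {u} {w} o → domain (from-opp̄ v u w o)
    ; sym      = λ {u} {w} o → to-opp̄ (opposition-sym (from-opp̄ v u w o))
    ; antirefl = λ {u} {w} o → antirefl (from-opp̄ v u w o)
    }
    where
    domain : ∀ {v u w} → OppositionIn̅ v u w → Adj̄ v u × Adj̄ v w
    domain (at-line ax bx _)           = ◂⇒incident ax , ◂⇒incident bx
    domain (at-point (ax , ay , _)) = ◂⇒incident ax , ◂⇒incident ay

    antirefl : ∀ {v u w} → OppositionIn̅ v u w → ¬ (u ≈̄ w)
    antirefl (at-line _ _ ¬a~b) e = ¬a~b (from-≈̄-point e)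
    antirefl (at-point o)       e = opposite̅⇒¬≍ o (from-≈̄-line e)

  -- Each class in the list is replaced by one representative incident with the given `x` or `a`, so
  -- the length is preserved.
  plump̅ : ∀ k → PlumpGraph k Γ → PlumpGraph k Γ̄
  plump̅ k plump (inj₂ x) S all S≤k with representatives S all
    where
    representatives : (S : List V̄) → All (Adj̄ (inj₂ x)) S → Σ (List V) λ T →
      All (Adj (proj₁ x)) T × length T ≡ length S ×
      (∀ {d} → d ◁ x → All (Opp (proj₁ x) (proj₁ d)) T → All (Opp̄ (inj₂ x) (inj₁ d)) S)
    representatives []           []           = [] , [] , refl , λ _ _ → []
    representatives (inj₂ _ ∷ _) (lift () ∷ _)
    representatives (inj₁ a ∷ S) (ax ∷ all) with representatives S all | incident⇒◂ {a} ax
    ... | T , adjs , len , f | a′ , a′~a , incident a′x =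
      proj₁ a′ ∷ T , adj-sym a′x ∷ adjs , cong suc len , λ { {d} dx (o ∷ os) →
        to-opp̄ (at-line (◁⇒◂ dx) (incident⇒◂ {a} ax) (λ d~a →
          opp⇒≉ o (_≐_.≈ (~∧◁⇒≐ (~-trans d~a (~-sym a′~a)) dx (incident a′x))))) ∷ f dx os }
  ... | T , adjs , len , f with plump (proj₁ x) T adjs (subst (_≤ k) (sym len) S≤k)
  ...   | d , xd , opps = inj₁ (d , point-at x xd) , ◂⇒incident (◁⇒◂ dx) , f dx opps
    where
    dx : (d , point-at x xd) ◁ x
    dx = incident (adj-sym xd)
  plump̅ k plump (inj₁ a) S all S≤k with representatives S all
    where
    representatives : (S : List V̄) → All (Adj̄ (inj₁ a)) S → Σ (List V) λ T →
      All (Adj (proj₁ a)) T × length T ≡ length S ×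
      (∀ {z} → a ◁ z → All (Opp (proj₁ a) (proj₁ z)) T → All (Opp̄ (inj₁ a) (inj₂ z)) S)
    representatives []           []           = [] , [] , refl , λ _ _ → []
    representatives (inj₁ _ ∷ _) (lift () ∷ _)
    representatives (inj₂ y ∷ S) (ay ∷ all) with representatives S all | ◂⇒◁ (incident⇒◂ {a} ay)
    ... | T , adjs , len , f | y′ , y′≍y , incident ay′ =
      proj₁ y′ ∷ T , ay′ ∷ adjs , cong suc len , λ { {z} az (o ∷ os) →
        to-opp̄ (at-point (opposite̅-resp ~-refl ◁⇒◂ y′≍y
          (opposite̅-intro (opposite {x = z} {a} {y′} o) ~-refl))) ∷ f az os }
  ... | T , adjs , len , f with plump (proj₁ a) T adjs (subst (_≤ k) (sym len) S≤k)
  ...   | z , az , opps = inj₂ (z , line-at a az) , ◂⇒incident (◁⇒◂ a◁z) , f a◁z opps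
    where
    a◁z : a ◁ (z , line-at a az)
    a◁z = incident az

  isVeldkampGraph̅ : IsVeldkampGraph Γ̄
  isVeldkampGraph̅ = record
    { isEquivalence = ≈̄-isEquivalence
    ; adj-resp      = adj̄-resp
    ; adj-sym       = λ {u} {v} → adj̄-sym {u} {v}
    ; adj-irrefl    = λ {u} {v} uv u≈v → adj̄⇒≢ {u} {v} uv (classSide-resp u≈v)
    ; opp-resp      = opp̄-resp
    ; opposition    = opposition̅
    ; 2-plump       = plump̅ 2 2-plump
    }

  isBipartition̅ : IsBipartition Γ̄ classSide
  isBipartition̅ = record { side-resp = classSide-resp ; side-adj = λ {u} {v} → adj̄⇒≢ {u} {v} }

  module Γ̄ᵍ = VeldkampGraph isVeldkampGraph̅ isBipartition̅

  unique₂̅ : ∀ {u v v′ w} → OppositionIn̅ v u w → OppositionIn̅ v′ u w → v′ ≈̄ v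
  unique₂̅ (at-line ax bx ¬a~b) (at-line ax′ bx′ _) = ≈̄-line (two-common⇒≍ ¬a~b ax′ bx′ ax bx)
  unique₂̅ (at-point o@(ax , ay , _)) (at-point (bx , by , _)) = ≈̄-point (classical λ ¬b~a →
    opposite̅⇒¬≍ o (two-common⇒≍ ¬b~a bx ax by ay))

  unique₃̅ : ∀ {u v v′ w w′ x} → classSide u ≡ point → OppositionIn̅ v u w → OppositionIn̅ w v x →
            OppositionIn̅ v′ u w′ → OppositionIn̅ w′ v′ x → w′ ≈̄ w
  unique₃̅ _ (at-line ax _ ¬a~b) (at-point o) (at-line ax′ _ ¬a~b′) (at-point o′) =
    ≈̄-point (~-sym (project̅-unique ax ¬a~b o ax′ ¬a~b′ o′))
  unique₃̅ () (at-point _) _ _ _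

  green̅ : ∀ x → classSide x ≡ line → TrivialOpposition _≈̄_ (Adj̄ x) (Opp̄ x)
  green̅ (inj₂ x) _ (inj₁ a) (inj₁ b) ax bx a≉b = ax , bx , λ a≃b → a≉b (Sum.inj₁ a≃b)
  green̅ (inj₂ x) _ (inj₂ _) _        (lift ()) _
  green̅ (inj₂ x) _ (inj₁ _) (inj₂ _) _ (lift ())

  uniqueness̅ : Uniqueness Γ̄ 4
  uniqueness̅ = Γ̄ᵍ.uniqueness₄
    (λ {u} {v} {v′} {w} o o′ → unique₂̅ (from-opp̄ v u w o) (from-opp̄ v′ u w o′))
    (λ {u} {v} {v′} {w} {w′} {x} u-pt o₁ o₂ o₃ o₄ → unique₃̅ u-pt
      (from-opp̄ v u w o₁) (from-opp̄ w v x o₂) (from-opp̄ v′ u w′ o₃) (from-opp̄ w′ v′ x o₄))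
    green̅

  connected̅ : Connected Γ̄
  connected̅ u v = Γ̄ᵍ.walk⇒path (λ _ _ → em) (walk u v)
    where
    up : ∀ {a x} → a ◁ x → Star Adj̄ (inj₁ a) (inj₂ x)
    up ax = ◂⇒incident (◁⇒◂ ax) ◅ ε

    down : ∀ {a x} → a ◁ x → Star Adj̄ (inj₂ x) (inj₁ a)
    down ax = ◂⇒incident (◁⇒◂ ax) ◅ ε

    to-line : ∀ u x → Star Adj̄ u (inj₂ x)
    to-line (inj₁ a) x with project a x
    ... | b , bx , w , aw , bw = up aw ◅◅ down bw ◅◅ up bx
    to-line (inj₂ y) x with point-on y
    ... | a , ay = down ay ◅◅ to-line (inj₁ a) x

    walk : ∀ u v → Star Adj̄ u v
    walk u (inj₂ x) = to-line u x
    walk u (inj₁ b) with line-through b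
    ... | y , by = to-line u y ◅◅ down by

  complete̅ : ∀ {a x b y d z} →
    OppositionIn̅ (inj₂ x) (inj₁ a) (inj₁ b) → OppositionIn̅ (inj₁ b) (inj₂ x) (inj₂ y) →
    OppositionIn̅ (inj₂ y) (inj₁ b) (inj₁ d) → OppositionIn̅ (inj₁ d) (inj₂ y) (inj₂ z) →
    ∃[ e ] ∃[ w ]
      OppositionIn̅ (inj₂ z) (inj₁ d) (inj₁ e) × OppositionIn̅ (inj₁ e) (inj₂ z) (inj₂ w) ×
      OppositionIn̅ (inj₂ w) (inj₁ e) (inj₁ a) × OppositionIn̅ (inj₁ a) (inj₂ w) (inj₂ x)
  complete̅ (at-line ax _ ¬a~b) (at-point o₁) (at-line _ _ ¬b~d) (at-point o₂@(_ , dz , _))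
    with extend̅ ax ¬a~b o₁ ¬b~d o₂
  ... | e , w , zew@(ez , ew , _) , wax@(aw , _) , ¬d~e , ¬e~a =
    e , w , at-line dz ez ¬d~e , at-point zew , at-line ew aw ¬e~a , at-point wax

  extension̅ : (p : Vec V̄ 6) → StraightPath Γ̄ p →
              Σ (Vec V̄ 9) λ z → StraightCircuit Γ̄ z × IsPath Γ̄ (EdgeOf Γ̄ z) p
  extension̅ (p₀ ∷ p₁ ∷ p₂ ∷ p₃ ∷ p₄ ∷ p₅ ∷ []) (_ , o₁ , o₂ , o₃ , o₄ , _) =
    via (from-opp̄ p₁ p₀ p₂ o₁) (from-opp̄ p₂ p₁ p₃ o₂) (from-opp̄ p₃ p₂ p₄ o₃) (from-opp̄ p₄ p₃ p₅ o₄)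
    where
    circuit : ∀ p₆ p₇ → OppositionIn̅ p₅ p₄ p₆ → OppositionIn̅ p₆ p₅ p₇ →
              OppositionIn̅ p₇ p₆ p₀ → OppositionIn̅ p₀ p₇ p₁ →
              Σ (Vec V̄ 9) λ z → StraightCircuit Γ̄ z ×
                IsPath Γ̄ (EdgeOf Γ̄ z) (p₀ ∷ p₁ ∷ p₂ ∷ p₃ ∷ p₄ ∷ p₅ ∷ [])
    circuit p₆ p₇ o₅ o₆ o₇ o₀ = Γ̄ᵍ.Circuits.octagon⇒extension uniqueness̅
      {p₀} {p₁} {p₂} {p₃} {p₄} {p₅} {p₆} {p₇}
      (o₁ , o₂ , o₃ , o₄ , to-opp̄ o₅ , to-opp̄ o₆ , to-opp̄ o₇ , to-opp̄ o₀)

    via : OppositionIn̅ p₁ p₀ p₂ → OppositionIn̅ p₂ p₁ p₃ →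
          OppositionIn̅ p₃ p₂ p₄ → OppositionIn̅ p₄ p₃ p₅ →
          Σ (Vec V̄ 9) λ z → StraightCircuit Γ̄ z ×
            IsPath Γ̄ (EdgeOf Γ̄ z) (p₀ ∷ p₁ ∷ p₂ ∷ p₃ ∷ p₄ ∷ p₅ ∷ [])
    via v₁@(at-line _ _ _) v₂@(at-point _) v₃@(at-line _ _ _) v₄@(at-point _)
      with complete̅ v₁ v₂ v₃ v₄
    ... | e , w , v₅ , v₆ , v₇ , v₀ = circuit (inj₁ e) (inj₂ w) v₅ v₆ v₇ v₀
    -- This path begins with a line and ends with a point, so it is completed from its other end.
    via v₁@(at-point _) v₂@(at-line _ _ _) v₃@(at-point _) v₄@(at-line _ _ _)
      with complete̅ (opposition-sym v₄) (opposition-sym v₃) (opposition-sym v₂) (opposition-sym v₁)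
    ... | e , w , v₀ , v₇ , v₆ , v₅ = circuit (inj₂ w) (inj₁ e)
      (opposition-sym v₅) (opposition-sym v₆) (opposition-sym v₇) (opposition-sym v₀)

  isQuad̅ : IsGreenVeldkampQuadrangle Γ̄ classSide
  isQuad̅ = record
    { isVeldkampPolygon = record
      { n≥2             = s≤s (s≤s z≤n)
      ; isVeldkampGraph = isVeldkampGraph̅
      ; connected       = connected̅
      ; bipartite       = classSide , isBipartition̅
      ; uniqueness      = uniqueness̅
      ; extension       = extension̅
      }
    ; isBipartition = isBipartition̅
    ; green         = green̅
    }

  -- Opposite vertices

  opaque
    op⇒opposite : ∀ {a b} → a op b → Opposite Γ 4 (proj₁ a) (proj₁ b)
    op⇒opposite ab@(x , root m y ax a≭m o b≭m by) =
      _ , straight₄ (green-opp ax (≡⇒◁ˡ o) a≭m) (_≡[_]_.opp o)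
                    (green-opp (≡⇒◁ʳ o) by (≭-sym b≭m)) ,
      ≈-refl , ≈-refl

    opᴸ⇒opposite : ∀ {x y} → x opᴸ y → Opposite Γ 4 (proj₁ x) (proj₁ y)
    opᴸ⇒opposite (a , w , b , a≭b , o₁@(opposite xaw) , o₂@(opposite wby)) =
      _ , straight₄ xaw (green-opp (≡⇒◁ʳ o₁) (≡⇒◁ˡ o₂) a≭b) wby , ≈-refl , ≈-refl

    opposite-side : ∀ {u v} → Opposite Γ 4 u v → side v ≡ side u
    opposite-side (_ ∷ _ ∷ _ ∷ _ ∷ _ ∷ [] , ((a , _ , b , _ , d , _ , e) , _) , v₀≈u , v₄≈v) =
      trans (sym (side-resp v₄≈v)) (trans (trans (adj²⇒≡ d e) (adj²⇒≡ a b)) (side-resp v₀≈u))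

    opposite⇒op : ∀ a b → Opposite Γ 4 (proj₁ a) (proj₁ b) → a op b
    opposite⇒op a b (v₀ ∷ v₁ ∷ v₂ ∷ v₃ ∷ v₄ ∷ [] , (_ , o₁ , o₂ , o₃ , _) , v₀≈a , v₄≈b) =
      op-resp (equal v₀≈a) (op-respʳ (equal v₄≈b)
        (op-via {a = A} {X} {M} {Y} {B} (incident (adj-sym (opp⇒adjˡ o₁))) (λ { (equal e) → opp⇒≉ o₁ e })
          (opposite o₂) (λ { (equal e) → opp⇒≉ o₃ (≈-sym e) }) (incident (adj-sym (opp⇒adjʳ o₃)))))
      where
      A M B : P
      X Y : L
      A = v₀ , trans (side-resp v₀≈a) (proj₂ a)
      X = v₁ , line-at A (adj-sym (opp⇒adjˡ o₁))
      M = v₂ , point-at X (opp⇒adjʳ o₁)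
      Y = v₃ , line-at M (opp⇒adjʳ o₂)
      B = v₄ , point-at Y (opp⇒adjʳ o₃)

    opposite⇒opᴸ : ∀ x y → Opposite Γ 4 (proj₁ x) (proj₁ y) → x opᴸ y
    opposite⇒opᴸ x y (v₀ ∷ v₁ ∷ v₂ ∷ v₃ ∷ v₄ ∷ [] , (_ , o₁ , o₂ , o₃ , _) , v₀≈x , v₄≈y) =
      A , W , B , (λ { (equal e) → opp⇒≉ o₂ e }) ,
      opposite (opp-resp ≈-refl v₀≈x ≈-refl o₁) , opposite (opp-resp ≈-refl ≈-refl v₄≈y o₃)
      where
      A B : P
      X W : L
      X = v₀ , trans (side-resp v₀≈x) (proj₂ x)
      A = v₁ , point-at X (adj-sym (opp⇒adjˡ o₁))
      W = v₂ , line-at A (opp⇒adjʳ o₁)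
      B = v₃ , point-at W (opp⇒adjʳ o₂)

  exists-op : ∀ a → ∃[ b ] a op b
  exists-op a with line-through a
  ... | x , ax with other-point ax
  ...   | m , mx , m≭a with separate (≭-sym m≭a , x , ax , mx)
  ...     | b , ab , _ = b , ab

  opposite̅-op : ∀ {a v} → Opposite Γ̄ 4 (inj₁ a) v → ∃[ b ] v ≡ inj₁ b × a op b
  opposite̅-op {a} (v₀ ∷ v₁ ∷ v₂ ∷ v₃ ∷ v₄ ∷ [] , (_ , o₁ , o₂ , o₃ , _) , e , e′) =
    go e e′ (from-opp̄ v₁ v₀ v₂ o₁) (from-opp̄ v₂ v₁ v₃ o₂) (from-opp̄ v₃ v₂ v₄ o₃)
    where
    go : ∀ {v v₀ v₁ v₂ v₃ v₄} → v₀ ≈̄ inj₁ a → v₄ ≈̄ v →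
         OppositionIn̅ v₁ v₀ v₂ → OppositionIn̅ v₂ v₁ v₃ → OppositionIn̅ v₃ v₂ v₄ →
         ∃[ b ] v ≡ inj₁ b × a op b
    go e@(Sum.inj₁ _) e′@(Sum.inj₁ _) (at-line ax _ ¬a~m) (at-point o) (at-line _ by ¬m~b) =
      _ , refl , op-~ (op-~ʳ (opposite̅⇒op o ax ¬a~m by (λ b~m → ¬m~b (~-sym b~m)))
        (from-≈̄-point e′)) (from-≈̄-point e)

  opposite̅-opᴸ : ∀ {x v} → Opposite Γ̄ 4 (inj₂ x) v → ∃[ y ] v ≡ inj₂ y × x opᴸ y
  opposite̅-opᴸ {x} (v₀ ∷ v₁ ∷ v₂ ∷ v₃ ∷ v₄ ∷ [] , (_ , o₁ , o₂ , o₃ , _) , e , e′) =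
    go e e′ (from-opp̄ v₁ v₀ v₂ o₁) (from-opp̄ v₂ v₁ v₃ o₂) (from-opp̄ v₃ v₂ v₄ o₃)
    where
    go : ∀ {v v₀ v₁ v₂ v₃ v₄} → v₀ ≈̄ inj₂ x → v₄ ≈̄ v →
         OppositionIn̅ v₁ v₀ v₂ → OppositionIn̅ v₂ v₁ v₃ → OppositionIn̅ v₃ v₂ v₄ →
         ∃[ y ] v ≡ inj₂ y × x opᴸ y
    go e@(Sum.inj₂ _) e′@(Sum.inj₂ _) (at-point o₁) (at-line _ _ ¬a~b) (at-point o₂) =
      _ , refl , opᴸ-intro (opposite̅-resp ~-refl (from-≈̄-line e) ◁⇒◂ o₁) ¬a~b
                           (opposite̅-resp ~-refl ◁⇒◂ (from-≈̄-line e′) o₂)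

  opaque
    op⇒opposite̅ : ∀ {a b} → a op b → Opposite Γ̄ 4 (inj₁ a) (inj₁ b)
    op⇒opposite̅ {a} {b} (x , root m y ax a≭m o b≭m by) =
      (inj₁ a ∷ inj₂ x ∷ inj₁ m ∷ inj₂ y ∷ inj₁ b ∷ []) ,
      Γ̄ᵍ.straight₄ {v = inj₂ x} {inj₁ a} {inj₁ m} {inj₂ y} {inj₁ b}
        (to-opp̄ (at-line (◁⇒◂ ax) (◁⇒◂ (≡⇒◁ˡ o)) (λ a~m → a≭m (~∧◁⇒≐ a~m ax (≡⇒◁ˡ o)))))
        (to-opp̄ (at-point (opposite̅-intro o ~-refl)))
        (to-opp̄ (at-line (◁⇒◂ (≡⇒◁ʳ o)) (◁⇒◂ by) (λ m~b → b≭m (≐-sym (~∧◁⇒≐ m~b (≡⇒◁ʳ o) by))))) ,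
      ≈̄-point ~-refl , ≈̄-point ~-refl

    opᴸ⇒opposite̅ : ∀ {x y} → x opᴸ y → Opposite Γ̄ 4 (inj₂ x) (inj₂ y)
    opᴸ⇒opposite̅ {x} {y} (a , w , b , a≭b , o₁ , o₂) =
      (inj₂ x ∷ inj₁ a ∷ inj₂ w ∷ inj₁ b ∷ inj₂ y ∷ []) ,
      Γ̄ᵍ.straight₄ {v = inj₁ a} {inj₂ x} {inj₂ w} {inj₁ b} {inj₂ y}
        (to-opp̄ (at-point (opposite̅-intro o₁ ~-refl)))
        (to-opp̄ (at-line (◁⇒◂ (≡⇒◁ʳ o₁)) (◁⇒◂ (≡⇒◁ˡ o₂)) (λ a~b → a≭b (~∧◁⇒≐ a~b (≡⇒◁ʳ o₁) (≡⇒◁ˡ o₂)))))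
        (to-opp̄ (at-point (opposite̅-intro o₂ ~-refl))) ,
      ≈̄-line ◁⇒◂ , ≈̄-line ◁⇒◂

  flat̅ : Flat Γ̄ 4
  flat̅ (inj₁ a) (inj₁ b) f = ≈̄-point (same-opposites⇒~ transfer)
    where
    transfer : ∀ e → a op e → b op e
    transfer e ae with opposite̅-op (Equivalence.to (f (inj₁ e)) (op⇒opposite̅ ae))
    ... | _ , refl , be = be
  flat̅ (inj₂ x) (inj₂ y) f = ≈̄-line (opposites⊆⇒≍ transfer)
    where
    transfer : ∀ z → x opᴸ z → y opᴸ z
    transfer z xz with opposite̅-opᴸ (Equivalence.to (f (inj₂ z)) (opᴸ⇒opposite̅ xz))
    ... | _ , refl , yz = yz
  flat̅ (inj₁ a) (inj₂ x) f with exists-op a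
  ... | b , ab with opposite̅-opᴸ (Equivalence.to (f (inj₁ b)) (op⇒opposite̅ ab))
  ...   | _ , () , _
  flat̅ (inj₂ x) (inj₁ a) f with exists-op a
  ... | b , ab with opposite̅-opᴸ (Equivalence.from (f (inj₁ b)) (op⇒opposite̅ ab))
  ...   | _ , () , _

  singletons-◂ : ClassesAreSingletons → ∀ {a x} → a ◂ x → a ◁ x
  singletons-◂ (points , _) {a} (b , b~a , bx) = ◁-resp (equal (points a b (~⇒≃ b~a))) ≐-refl bx

  flat⇒singletons : Flat Γ 4 → ClassesAreSingletons
  flat⇒singletons flat = points , lines
    where
    transfer : ∀ {a b v} → a ~ b → Opposite Γ 4 (proj₁ a) v → Opposite Γ 4 (proj₁ b) v
    transfer {a} {b} {v} a~b opp =
      op⇒opposite (op-~ (opposite⇒op a (v , trans (opposite-side opp) (proj₂ a)) opp) a~b)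

    points : ∀ a b → b ≃ a → proj₁ b ≈ proj₁ a
    points a b b≃a = flat _ _ λ v → mk⇔ (transfer b~a) (transfer (~-sym b~a))
      where
      b~a : b ~ a
      b~a = ≃⇒~ {b} {a} b≃a

    on : ∀ {a x} → a ◂ x → a ◁ x
    on {a} (b , b~a , bx) = ◁-resp (equal (points a b (~⇒≃ b~a))) ≐-refl bx

    -- As point classes are singletons, equivalent lines have two points in common.
    lines : ∀ x y → y ≋ x → proj₁ y ≈ proj₁ x
    lines x y y≋x with point-on y
    ... | a , ay with other-point ay
    ...   | b , by , b≭a = _≐_.≈ (join-unique b≭a by ay (on (≋⇒≍ y≋x by)) (on (≋⇒≍ y≋x ay)))

  mixed : ∀ (a : P) (x : L) → ¬ (∀ v → Opposite Γ 4 (proj₁ a) v → Opposite Γ 4 (proj₁ x) v)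
  mixed a x f with exists-op a
  ... | b , ab = point≢line
    (trans (sym (proj₂ b)) (trans (opposite-side (f _ (op⇒opposite ab))) (proj₂ x)))

  singletons⇒flat : ClassesAreSingletons → Flat Γ 4
  singletons⇒flat (points , lines) u v f with side u in u-side | side v in v-side
  ... | point | point = points (v , v-side) (u , u-side) (~⇒≃ (same-opposites⇒~ transfer))
    where
    transfer : ∀ e → (u , u-side) op e → (v , v-side) op e
    transfer e ue = opposite⇒op (v , v-side) e (Equivalence.to (f (proj₁ e)) (op⇒opposite ue))
  ... | line | line = lines _ _ (≍⇒≋ (opposites⊆⇒≍ transfer))
    where
    transfer : ∀ z → (u , u-side) opᴸ z → (v , v-side) opᴸ z
    transfer z uz = opposite⇒opᴸ (v , v-side) z (Equivalence.to (f (proj₁ z)) (opᴸ⇒opposite uz))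
  ... | point | line = ⊥-elim (mixed (u , u-side) (v , v-side) (λ z → Equivalence.to (f z)))
  ... | line | point = ⊥-elim (mixed (v , v-side) (u , u-side) (λ z → Equivalence.from (f z)))

  -- The map toClass

  class : ∀ v → ClassOf Γ side v (toClass v)
  class v = classOf Γ (λ _ → side) _ _ v

  same-classes : ∀ {u v ū v̄} → u ≈ v → ClassOf Γ side u ū → ClassOf Γ side v v̄ → ū ≈̄ v̄
  same-classes u≈v (is-point _)    (is-point _)    = Sum.inj₁ (inj₁ u≈v)
  same-classes u≈v (is-line _)     (is-line _)     = Sum.inj₂ (inj₁ u≈v ◅ ε)
  same-classes u≈v (is-point u-pt) (is-line v-ln)  = ⊥-elim (point-line-≉ u-pt v-ln u≈v)
  same-classes u≈v (is-line u-ln)  (is-point v-pt) = ⊥-elim (point-line-≉ v-pt u-ln (≈-sym u≈v))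

  class-adj : ∀ {u v ū v̄} → ClassOf Γ side u ū → ClassOf Γ side v v̄ → Adj u v → Adj̄ ū v̄
  class-adj (is-point u-pt) (is-line v-ln) uv = ◂⇒incident (◁⇒◂ uv′)
    where
    uv′ : (_ , u-pt) ◁ (_ , v-ln)
    uv′ = incident uv
  class-adj (is-line u-ln) (is-point v-pt) uv = ◂⇒incident (◁⇒◂ vu)
    where
    vu : (_ , v-pt) ◁ (_ , u-ln)
    vu = incident (adj-sym uv)
  class-adj (is-point u-pt) (is-point v-pt) uv = ⊥-elim (side-adj uv (trans u-pt (sym v-pt)))
  class-adj (is-line u-ln)  (is-line v-ln)  uv = ⊥-elim (side-adj uv (trans u-ln (sym v-ln)))

  class-opp : ∀ {v u w v̄ ū w̄} → ClassOf Γ side v v̄ → ClassOf Γ side u ū → ClassOf Γ side w w̄ →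
              Opp v u w → OppositionIn̅ v̄ ū w̄
  class-opp (is-point v-pt) (is-line u-ln) (is-line w-ln) o = at-point (opposite̅-intro o′ ~-refl)
    where
    o′ : (_ , u-ln) ≡[ (_ , v-pt) ] (_ , w-ln)
    o′ = opposite o
  class-opp (is-line v-ln) (is-point u-pt) (is-point w-pt) o =
    at-line (◁⇒◂ uv) (◁⇒◂ wv) (λ u~w → opp⇒≉ o (_≐_.≈ (~∧◁⇒≐ u~w uv wv)))
    where
    uv : (_ , u-pt) ◁ (_ , v-ln)
    uv = incident (adj-sym (opp⇒adjˡ o))
    wv : (_ , w-pt) ◁ (_ , v-ln)
    wv = incident (adj-sym (opp⇒adjʳ o))
  class-opp (is-point v-pt) (is-point u-pt) _ o = ⊥-elim (side-adj (opp⇒adjˡ o) (trans v-pt (sym u-pt)))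
  class-opp (is-point v-pt) _ (is-point w-pt) o = ⊥-elim (side-adj (opp⇒adjʳ o) (trans v-pt (sym w-pt)))
  class-opp (is-line v-ln)  (is-line u-ln)  _ o = ⊥-elim (side-adj (opp⇒adjˡ o) (trans v-ln (sym u-ln)))
  class-opp (is-line v-ln)  _ (is-line w-ln)  o = ⊥-elim (side-adj (opp⇒adjʳ o) (trans v-ln (sym w-ln)))

  module _ (singletons : ClassesAreSingletons) where

    class-injective : ∀ {u v ū v̄} → ClassOf Γ side u ū → ClassOf Γ side v v̄ → ū ≈̄ v̄ → u ≈ v
    class-injective (is-point u-pt) (is-point v-pt) (Sum.inj₁ u≃v) =
      proj₁ singletons (_ , v-pt) (_ , u-pt) u≃v
    class-injective (is-line _)  (is-line _)  (Sum.inj₂ u≋v) = proj₂ singletons _ _ u≋v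

    class-adj⁻¹ : ∀ {u v ū v̄} → ClassOf Γ side u ū → ClassOf Γ side v v̄ → Adj̄ ū v̄ → Adj u v
    class-adj⁻¹ (is-point u-pt) (is-line _) ux =
      _◁_.adj (singletons-◂ singletons (incident⇒◂ {_ , u-pt} ux))
    class-adj⁻¹ (is-line _) (is-point v-pt) vx =
      adj-sym (_◁_.adj (singletons-◂ singletons (incident⇒◂ {_ , v-pt} vx)))
    class-adj⁻¹ (is-point _) (is-point _) (lift ())
    class-adj⁻¹ (is-line _)  (is-line _)  (lift ())

    class-opp⁻¹ : ∀ {v u w v̄ ū w̄} → ClassOf Γ side v v̄ → ClassOf Γ side u ū → ClassOf Γ side w w̄ →
                  OppositionIn̅ v̄ ū w̄ → Opp v u w
    class-opp⁻¹ (is-point _) (is-line _) (is-line _) (at-point o@(vu , vw , _)) =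
      _≡[_]_.opp (opposite̅⇒≡ o ~-refl (singletons-◂ singletons vu) ◁⇒◂ (singletons-◂ singletons vw) ◁⇒◂)
    class-opp⁻¹ (is-line _) (is-point _) (is-point _) (at-line uv wv ¬u~w) =
      green-opp (singletons-◂ singletons uv) (singletons-◂ singletons wv) (λ u≐w → ¬u~w (inj₁ u≐w))

    singletons⇒isomorphism : IsIsomorphism Γ Γ̄ toClass
    singletons⇒isomorphism = record
      { congruent = λ {u} {v} u≈v → same-classes u≈v (class u) (class v)
      ; bijective = (λ {u} {v} → class-injective (class u) (class v)) , surjective
      ; adj⇔ = λ u v → mk⇔ (class-adj (class u) (class v)) (class-adj⁻¹ (class u) (class v))
      ; opp⇔ = λ v u w → mk⇔
          (λ o → to-opp̄ (class-opp (class v) (class u) (class w) o))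
          (λ o → class-opp⁻¹ (class v) (class u) (class w)
                   (from-opp̄ (toClass v) (toClass u) (toClass w) o))
      }
      where
      surjective : ∀ ū → ∃[ u ] (∀ {v} → v ≈ u → toClass v ≈̄ ū)
      surjective (inj₁ (u , u-pt)) = u , λ {v} v≈u → same-classes v≈u (class v) (is-point u-pt)
      surjective (inj₂ (u , u-ln)) = u , λ {v} v≈u → same-classes v≈u (class v) (is-line u-ln)

  isomorphism⇒singletons : IsIsomorphism Γ Γ̄ toClass → ClassesAreSingletons
  isomorphism⇒singletons iso =
    (λ a b b≃a → injective (point-classes {b} {a} b≃a (class (proj₁ b)) (class (proj₁ a)))) ,
    (λ x y y≋x → injective (line-classes {y} {x} y≋x (class (proj₁ y)) (class (proj₁ x))))
    where
    injective : ∀ {u v} → toClass u ≈̄ toClass v → u ≈ v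
    injective = proj₁ (IsIsomorphism.bijective iso)

    point-classes : ∀ {a b ā b̄} → a ≃ b →
      ClassOf Γ side (proj₁ a) ā → ClassOf Γ side (proj₁ b) b̄ → ā ≈̄ b̄
    point-classes a≃b (is-point _) (is-point _) = Sum.inj₁ a≃b
    point-classes {a} _ (is-line a-ln) _ = ⊥-elim (point≢line (trans (sym (proj₂ a)) a-ln))
    point-classes {b = b} _ _ (is-line b-ln) = ⊥-elim (point≢line (trans (sym (proj₂ b)) b-ln))

    line-classes : ∀ {x y x̄ ȳ} → x ≋ y →
      ClassOf Γ side (proj₁ x) x̄ → ClassOf Γ side (proj₁ y) ȳ → x̄ ≈̄ ȳ
    line-classes x≋y (is-line _) (is-line _) = Sum.inj₂ (inj₁ ≈-refl ◅ (x≋y ◅◅ (inj₁ ≈-refl ◅ ε)))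
    line-classes {x} _ (is-point x-pt) _ = ⊥-elim (point≢line (trans (sym x-pt) (proj₂ x)))
    line-classes {y = y} _ _ (is-point y-pt) = ⊥-elim (point≢line (trans (sym y-pt) (proj₂ y)))

mainTheorem14 : ∀ {c ℓ} → ExcludedMiddle (c ⊔ ℓ) →
    (Γ : RawVeldkampGraph c ℓ) (side : RawVeldkampGraph.V Γ → Side) →
    IsGreenVeldkampQuadrangle Γ side →
    let open Classes Γ side in
    (IsGreenVeldkampQuadrangle Γ̄ classSide × Flat Γ̄ 4) ×
    (Flat Γ 4 ⇔ ClassesAreSingletons) ×
    (ClassesAreSingletons ⇔ IsIsomorphism Γ Γ̄ toClass) ×
    (∀ (k : ℕ) → 3 ≤ k → PlumpGraph k Γ → PlumpGraph k Γ̄)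
mainTheorem14 em Γ side isQuad =
  (isQuad̅ , flat̅) ,
  mk⇔ flat⇒singletons singletons⇒flat ,
  mk⇔ singletons⇒isomorphism isomorphism⇒singletons ,
  λ k _ → plump̅ k
  where open Quotient em isQuad
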